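{- Let $m,n$ be positive integers and $\alpha_1,\dots,\alpha_m\ge0$ integers with $\sum_i i\alpha_i=n$. For $\pi\in\mathcal{PF}_{m,n}$ let $\mathrm{vstr}(\pi)$ be the labeled lattice configuration in the $m\times(n+m)$ grid obtained as follows: if column $x$ ($0\le x\le m-1$) of $\pi$ contains $h_x$ cars, column $x$ of $\mathrm{vstr}(\pi)$ contains $h_x+1$ cars (the path has $h_x+1$ north steps at abscissa $x$); the lowest cell of each column contains one of the cars $1,\dots,m$, these being assigned so that $\mathrm{rank}(1)>\mathrm{rank}(2)>\dots>\mathrm{rank}(m)$ in $\mathrm{vstr}(\pi)$; and above it, column $x$ contains the cars $i+m$ for the cars $i$ of column $x$ of $\pi$, in the same bottom-to-top order. Then $\mathrm{vstr}$ restricts to a bijection $$\{\pi\in\mathcal{PF}_{m,n}:\mathrm{pides}(\pi)=m^{\alpha_m}\cdots1^{\alpha_1}\}\to\{\pi\in\mathcal{PF}_{m,n+m}:\mathrm{pides}(\pi)=m^{\alpha_m+1}(m-1)^{\alpha_{m-1}}\cdots1^{\alpha_1}\},$$ and $\mathrm{area}(\mathrm{vstr}(\pi))=\mathrm{area}(\pi)$, $\mathrm{dinv}(\mathrm{vstr}(\pi))=\mathrm{dinv}(\pi)$, $\mathrm{ret}(\mathrm{vstr}(\pi))=\mathrm{ret}(\pi)$.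
   Context: An $(m,n)$-Dyck path is a north/east lattice path from $(0,0)$ to $(m,n)$ weakly above $y=\frac nm x$. An $(m,n)$-parking function $\pi$ is such a path $\Pi(\pi)$ whose $n$ north steps are labeled bijectively by $1,\dots,n$ (cars, in the cells just right of the north steps), increasing upward in each column; $\mathcal{PF}_{m,n}$ is the set. With $d=\gcd(m,n)$, cell $(x,y)$ (lower-left corner) has rank $my-nx+\lfloor xd/m\rfloor$; a car's rank is that of its cell. $\mathrm{ides}(\pi)=\{i:\mathrm{rank}(i)<\mathrm{rank}(i+1)\}=\{i_1<\dots<i_r\}$, $\mathrm{pides}(\pi)=(i_1,i_2-i_1,\dots,n-i_r)$; $m^{\alpha_m}\cdots1^{\alpha_1}$ denotes the composition with $\alpha_m$ parts $m$, then $\alpha_{m-1}$ parts $m-1$, …, then $\alpha_1$ parts $1$. $\mathrm{area}$ = number of full cells between path and diagonal. $\lambda(P)$ = partition (English) of cells of the rectangle above $P$; $\mathrm{arm}(c),\mathrm{leg}(c)$ as usual; $\mathrm{pdinv}(P)=\#\{c:\frac{\mathrm{arm}(c)}{\mathrm{leg}(c)+1}\le\frac mn<\frac{\mathrm{arm}(c)+1}{\mathrm{leg}(c)}\}$ ($x/0=\infty$); $\mathrm{tdinv}(\pi)=\#\{i<j:\mathrm{rank}(i)<\mathrm{rank}(j)<\mathrm{rank}(i)+m\}$; $\mathrm{maxdinv}(P)$ = maximum tdinv over parking functions on $P$; $\mathrm{dinv}=\mathrm{tdinv}+\mathrm{pdinv}-\mathrm{maxdinv}$. With $(m,n)=(km_0,kn_0)$,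 $\gcd(m_0,n_0)=1$, $\mathrm{ret}(\pi)$ is the least $i\ge1$ with the path through $(im_0,in_0)$. -}

module Defs where

open import Data.Bool using (Bool; true; false; _∧_; if_then_else_)
open import Data.Nat using (ℕ; zero; suc; _+_; _*_; _∸_; _≤_; _<_; _⊔_; _≡ᵇ_; _<ᵇ_; _≤ᵇ_)
open import Data.Nat.DivMod using (_/_)
open import Data.Nat.GCD using (gcd)
open import Data.Fin using (Fin; toℕ)
open import Data.Vec using (Vec; lookup; tabulate; toList; _++_) renaming ([] to []ᵥ; _∷_ to _∷ᵥ_)
open import Data.List using (List; []; _∷_; upTo; allFin; map; concatMap; foldr; replicate) renaming (_++_ to _++ₗ_)
open import Data.Integer using (ℤ; +_)
import Data.Integer as ℤ
open import Relation.Nullary using (does)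

count : {A : Set} → (A → Bool) → List A → ℕ
count p []       = 0
count p (a ∷ as) = (if p a then 1 else 0) + count p as

findD : {A : Set} → (A → Bool) → List A → A → A
findD p []       d = d
findD p (a ∷ as) d = if p a then a else findD p as d

-- natural-number division with a total convention for divisor 0 (never used with 0 here)
divN : ℕ → ℕ → ℕ
divN a zero    = 0
divN a (suc k) = a / suc k

_<ℤᵇ_ : ℤ → ℤ → Bool
a <ℤᵇ b = does (a ℤ.<? b)

-- Encoding of (m,n)-parking functions.
-- A labeled path in the m × n grid whose labels increase upward in each
-- column is determined by the column of each car: v : Vec (Fin m) n,
-- lookup v i = abscissa x (0 ≤ x ≤ m-1) of the north step labeled by car
-- i+1 (cars are 1-based in the paper, 0-based Fin indices here).
-- Column x of the path has as many north steps as cars with column x;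
-- within a column the cars are stacked in increasing order bottom-to-top.

-- number of cars in columns < a  (= height at which column a starts, H_{a-1})
belowN : {m n : ℕ} → Vec (Fin m) n → ℕ → ℕ
belowN v a = count (λ c → toℕ c <ᵇ a) (toList v)

-- number of cars in columns ≤ a  (= height of the path's east step in column a, H_a)
uptoN : {m n : ℕ} → Vec (Fin m) n → ℕ → ℕ
uptoN v a = count (λ c → toℕ c ≤ᵇ a) (toList v)

colCount : {m n : ℕ} → Vec (Fin m) n → Fin m → ℕ
colCount v x = count (λ c → toℕ c ≡ᵇ toℕ x) (toList v)

-- Dyck condition: path weakly above y = (n/m) x, checked at the lattice
-- points (x+1, H_x) ending the east steps (the lowest points of the path
-- on each vertical line), i.e.  n(x+1) ≤ m H_x.
IsPF : {m n : ℕ} → Vec (Fin m) n → Set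
IsPF {m} {n} v = (x : Fin m) → n * (toℕ x + 1) ≤ m * uptoN v (toℕ x)

-- rank of the cell with lower-left corner (x,y) in the (m,n) grid:
--   m y - n x + ⌊ x d / m ⌋ ,  d = gcd(m,n)
rank : ℕ → ℕ → ℕ → ℕ → ℤ
rank m n x y = ((+ (m * y)) ℤ.- (+ (n * x))) ℤ.+ (+ divN (x * gcd m n) m)

carX : {m n : ℕ} → Vec (Fin m) n → Fin n → ℕ
carX v i = toℕ (lookup v i)

carY : {m n : ℕ} → Vec (Fin m) n → Fin n → ℕ
carY {n = n} v i =
  belowN v (carX v i)
  + count (λ j → (toℕ j <ᵇ toℕ i) ∧ (carX v j ≡ᵇ carX v i)) (allFin n)

carRank : {m n : ℕ} → Vec (Fin m) n → Fin n → ℤ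
carRank {m} {n} v i = rank m n (carX v i) (carY v i)

ranks : {m n : ℕ} → Vec (Fin m) n → List ℤ
ranks {n = n} v = map (carRank v) (allFin n)

idesL : ℕ → List ℤ → List ℕ
idesL k []           = []
idesL k (a ∷ [])     = []
idesL k (a ∷ b ∷ rs) = (if a <ℤᵇ b then k ∷ [] else []) ++ₗ idesL (suc k) (b ∷ rs)

ides : {m n : ℕ} → Vec (Fin m) n → List ℕ
ides v = idesL 1 (ranks v)

diffs : ℕ → List ℕ → ℕ → List ℕ
diffs prev []       n = (n ∸ prev) ∷ []
diffs prev (i ∷ is) n = (i ∸ prev) ∷ diffs i is n

pides : {m n : ℕ} → Vec (Fin m) n → List ℕ
pides {n = n} v = diffs 0 (ides v) n

compo : ℕ → (ℕ → ℕ) → List ℕ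
compo zero    α = []
compo (suc i) α = replicate (α (suc i)) (suc i) ++ₗ compo i α

wsum : ℕ → (ℕ → ℕ) → ℕ
wsum zero    α = 0
wsum (suc i) α = suc i * α (suc i) + wsum i α

-- area: full cells (x,y) (0 ≤ x < m, 0 ≤ y < n) lying below the path
-- (y < H_x) and above the diagonal (lower-right corner (x+1,y) weakly
-- above y = (n/m) x, i.e. n(x+1) ≤ m y).

area : {m n : ℕ} → Vec (Fin m) n → ℕ
area {m} {n} v =
  foldr _+_ 0 (map (λ x →
     count (λ y → (y <ᵇ uptoN v (toℕ x)) ∧ (n * (toℕ x + 1) ≤ᵇ m * y)) (upTo n))
   (allFin m))

tdinvL : ℕ → List ℤ → ℕ
tdinvL m []       = 0
tdinvL m (r ∷ rs) = count (λ s → (r <ℤᵇ s) ∧ (s <ℤᵇ (r ℤ.+ (+ m)))) rs + tdinvL m rs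

tdinv : {m n : ℕ} → Vec (Fin m) n → ℕ
tdinv {m} v = tdinvL m (ranks v)

allVecs : (m n : ℕ) → List (Vec (Fin m) n)
allVecs m zero    = []ᵥ ∷ []
allVecs m (suc n) = concatMap (λ c → map (c ∷ᵥ_) (allVecs m n)) (allFin m)

samePath : {m n : ℕ} → Vec (Fin m) n → Vec (Fin m) n → Bool
samePath {m} w v = foldr _∧_ true (map (λ x → colCount w x ≡ᵇ colCount v x) (allFin m))

maxdinv : {m n : ℕ} → Vec (Fin m) n → ℕ
maxdinv {m} {n} v =
  foldr _⊔_ 0 (map (λ w → if samePath w v then tdinv w else 0) (allVecs m n))

-- "a / b ≤ c / d" with b ≠ 0, and "a / b < c / d" with the convention x/0 = ∞
fracLeᵇ : ℕ → ℕ → ℕ → ℕ → Bool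
fracLeᵇ a b c d = a * d ≤ᵇ c * b

fracLtᵇ : ℕ → ℕ → ℕ → ℕ → Bool
fracLtᵇ a b c zero    = true
fracLtᵇ a b c (suc d) = a * suc d <ᵇ c * b

-- pdinv: cells c = (x,y) of the rectangle above the path (H_x ≤ y < n),
-- forming λ(P) in English notation; arm(c) = cells of λ strictly right of c
-- in its row, leg(c) = cells of λ strictly below c in its column.
armC : {m n : ℕ} → Vec (Fin m) n → Fin m → ℕ → ℕ
armC {m} v x y = count (λ x' → (toℕ x <ᵇ toℕ x') ∧ (uptoN v (toℕ x') ≤ᵇ y)) (allFin m)

legC : {m n : ℕ} → Vec (Fin m) n → Fin m → ℕ → ℕ
legC v x y = y ∸ uptoN v (toℕ x)

pdinv : {m n : ℕ} → Vec (Fin m) n → ℕ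
pdinv {m} {n} v =
  foldr _+_ 0 (map (λ x →
     count (λ y → (uptoN v (toℕ x) ≤ᵇ y)
                  ∧ fracLeᵇ (armC v x y) (suc (legC v x y)) m n
                  ∧ fracLtᵇ m n (suc (armC v x y)) (legC v x y))
           (upTo n))
   (allFin m))

dinv : {m n : ℕ} → Vec (Fin m) n → ℤ
dinv v = ((+ tdinv v) ℤ.+ (+ pdinv v)) ℤ.- (+ maxdinv v)

passes : {m n : ℕ} → Vec (Fin m) n → ℕ → ℕ → Bool
passes v a b = (belowN v a ≤ᵇ b) ∧ (b ≤ᵇ uptoN v a)

ret : {m n : ℕ} → Vec (Fin m) n → ℕ
ret {m} {n} v =
  let k  = gcd m n
      m₀ = divN m k
      n₀ = divN n k
  in findD (λ i → passes v (i * m₀) (i * n₀)) (map suc (upTo k)) k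

-- vstr : (m,n)-parking functions → labeled configurations in the
-- m × (n+m) grid (here the car count is m + n).
-- Column x gets one extra north step at its bottom; in the new path the
-- bottom cell of column x is (x, H_{x-1} + x).  The cars 1..m are placed
-- in these bottom cells so that rank(1) > rank(2) > … > rank(m) (ranks in
-- the (m, n+m) grid); car i+m goes where car i was (same column, same
-- relative order).

bottomRank : {m n : ℕ} → Vec (Fin m) n → Fin m → ℤ
bottomRank {m} {n} v x = rank m (m + n) (toℕ x) (belowN v (toℕ x) + toℕ x)

bottomPos : {m n : ℕ} → Vec (Fin m) n → Fin m → ℕ
bottomPos {m} v x = count (λ x' → bottomRank v x <ℤᵇ bottomRank v x') (allFin m)

-- column of car k+1 (k = 0..m-1): the column whose bottom cell has the
-- (k+1)-st largest rank (ranks of distinct cells are distinct; the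
-- default k is never used)
bottomCols : {m n : ℕ} → Vec (Fin m) n → Vec (Fin m) m
bottomCols {m} v = tabulate (λ k → findD (λ x → bottomPos v x ≡ᵇ toℕ k) (allFin m) k)

vstr : {m n : ℕ} → Vec (Fin m) n → Vec (Fin m) (m + n)
vstr v = bottomCols v ++ v

{-# OPTIONS --safe #-}

-- Stretching moves a cell of column x up by x + 1 rows and thereby raises its rank by exactly m,
-- while the new bottom cell of column x receives the rank of the old lowest cell of that column.
-- Hence the first m ranks decrease, an ascent follows, and the remaining descents are unchanged.
-- Conversely, ranks increase upward in a column, so a first run of m decreasing ranks puts the
-- first m cars into distinct columns.
--
-- For dinv, maxdinv is the number of all pairs of cells with ranks r < s < r + m, because the
-- labelling in order of rank realises all of them.  So maxdinv − tdinv grows by the pairs whose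
-- larger-ranked cell s is a bottom cell.  A cell counted by pdinv is an east step and a later north
-- step with overlapping rank intervals.  For a fixed column q of north steps, the growth of this
-- number equals the growth of the former up to a telescoping sum that vanishes; it telescopes
-- because the level of the path drops by at most n from one column to the next.

module Submission where

open import Defs
open import Data.Bool using (Bool; true; false; _∧_; if_then_else_)
open import Data.Bool.Properties using (∧-identityʳ)
open import Data.Fin as Fin using (Fin; zero; suc; toℕ; _↑ˡ_; _↑ʳ_)
open import Data.Fin.Permutation using (Permutation; permutation)
import Data.Fin.Properties as Fin
open import Data.Integer as ℤ using (ℤ; +_; 0ℤ; 1ℤ)
import Data.Integer.Properties as ℤ
open import Data.Integer.Tactic.RingSolver using () renaming (solve-∀ to ℤ-solve-∀)
open import Data.List as List using (List; []; _∷_; upTo; applyUpTo)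
open import Data.List.Membership.Propositional using (_∈_)
open import Data.List.Membership.Propositional.Properties using (∈-map⁺; ∈-concatMap⁺; ∈-allFin)
open import Data.List.Properties using (map-tabulate; tabulate-cong; map-applyUpTo; ∷-injectiveˡ; ∷-injectiveʳ)
open import Data.List.Relation.Unary.Any as Any using (here; there)
open import Data.Nat
  using (ℕ; zero; suc; _+_; _*_; _∸_; _⊔_; _≤_; _<_; z≤n; s≤s; s≤s⁻¹; _≟_; _≤?_; _<?_; NonZero; ≢-nonZero; >-nonZero; >-nonZero⁻¹)
open import Data.Nat.Coprimality using (coprime-/gcd; coprime-divisor)
open import Data.Nat.Divisibility using (_∣_; ∣⇒≤; ∣-antisym; ∣m+n∣m⇒∣n; ∣m∣n⇒∣m+n; *-cancelʳ-∣; m∣m*n)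
open import Data.Nat.DivMod
  using (_/_; _%_; m≡m%n+[m/n]*n; m%n<n; m/n*n≤m; m/n*n≡m; /-monoˡ-≤; m<n*o⇒m/o<n; m<n⇒m%n≡m; [m+kn]%n≡m%n; +-distrib-/-∣ˡ)
open import Data.Nat.GCD using (gcd; gcd[m,n]∣m; gcd[m,n]∣n; gcd-greatest; gcd[m,n]≢0)
import Data.Nat.Properties as ℕ
open import Data.Nat.Tactic.RingSolver using () renaming (solve-∀ to ℕ-solve-∀)
open import Data.Product using (_×_; _,_; proj₁; proj₂; ∃; Σ-syntax)
open import Data.Sum using (_⊎_; inj₁; inj₂)
open import Data.Vec as Vec using (Vec; lookup; toList; _++_; splitAt)
open import Data.Vec.Properties as Vec using (lookup∘tabulate; lookup-++ˡ; lookup-++ʳ; ++-injectiveʳ)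
open import Function using (_∘_; id)
open import Function.Bundles using (mk⇔)
open import Relation.Binary.Definitions using (tri<; tri≈; tri>)
open import Relation.Binary.PropositionalEquality
  using (_≡_; _≢_; refl; sym; trans; cong; cong₂; subst; subst₂; module ≡-Reasoning)
open import Relation.Nullary using (¬_; Dec; yes; no; does; contradiction)
open import Relation.Nullary.Decidable using (_×-dec_; dec-true; dec-false; does-⇔)
open import Algebra.Properties.CommutativeMonoid.Sum ℕ.+-0-commutativeMonoid
  using (sum; ∑-distrib-+; sum-permute) renaming (sum-cong-≗ to sum-cong)

-- Indicators

-- The obstacle in the `dinv` part is that its two counts use different orders. `pdinv` compares
-- levels `m y - n x`, with one weak and one strict inequality; attacks compare ranks, strictly, and
-- ranks carry the floor term. Levels are multiples of `gcd m n`, while the floor term is weakly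
-- increasing in the column and stays below that gcd. Hence ranks order cells by level first, and of
-- two cells of equal level the one in the earlier column has the smaller rank. A weak level
-- inequality from an earlier to a later column is therefore a strict rank inequality, and this is
-- why every pair of columns is written with `p < q` before the counts are compared. The Dyck
-- condition enters through the end terms of the telescoping sums. They sit at column `0`, whose
-- level is zero, and at column `q` itself, and at both the level does not exceed that of `q`.

⟦_⟧ : {P : Set} → Dec P → ℕ
⟦ d ⟧ = if does d then 1 else 0

⟦⟧-yes : {P : Set} (d : Dec P) → P → ⟦ d ⟧ ≡ 1
⟦⟧-yes d p = cong (if_then 1 else 0) (dec-true d p)

⟦⟧-no : {P : Set} (d : Dec P) → ¬ P → ⟦ d ⟧ ≡ 0
⟦⟧-no d ¬p = cong (if_then 1 else 0) (dec-false d ¬p)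

⟦⟧-cong : {P Q : Set} (d : Dec P) (e : Dec Q) → (P → Q) → (Q → P) → ⟦ d ⟧ ≡ ⟦ e ⟧
⟦⟧-cong (yes p) e f g = sym (⟦⟧-yes e (f p))
⟦⟧-cong (no ¬p) e f g = sym (⟦⟧-no e (¬p ∘ g))

⟦⟧-mono : {P Q : Set} (d : Dec P) (e : Dec Q) → (P → Q) → ⟦ d ⟧ ≤ ⟦ e ⟧
⟦⟧-mono (yes p) e f = ℕ.≤-reflexive (sym (⟦⟧-yes e (f p)))
⟦⟧-mono (no ¬p) e f = z≤n

⟦⟧-⊎ : {P Q R : Set} (d : Dec P) (e : Dec Q) (k : Dec R) →
       (P → Q ⊎ R) → (Q → P) → (R → P) → (Q → ¬ R) → ⟦ d ⟧ ≡ ⟦ e ⟧ + ⟦ k ⟧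
⟦⟧-⊎ (yes p) e k f g h ¬qr with f p
... | inj₁ q = sym (cong₂ _+_ (⟦⟧-yes e q) (⟦⟧-no k (¬qr q)))
... | inj₂ r = sym (cong₂ _+_ (⟦⟧-no e (λ q → ¬qr q r)) (⟦⟧-yes k r))
⟦⟧-⊎ (no ¬p) e k f g h ¬qr = sym (cong₂ _+_ (⟦⟧-no e (¬p ∘ g)) (⟦⟧-no k (¬p ∘ h)))

⟦⟧-pos : {P : Set} (d : Dec P) → 0 < ⟦ d ⟧ → P
⟦⟧-pos (yes p) _ = p
⟦⟧-pos (no _) ()

⟦⟧≤1 : {P : Set} (d : Dec P) → ⟦ d ⟧ ≤ 1
⟦⟧≤1 (yes _) = ℕ.≤-refl
⟦⟧≤1 (no _) = z≤n

-- Finite sums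

sum-zero : ∀ {n} (f : Fin n → ℕ) → (∀ i → f i ≡ 0) → sum f ≡ 0
sum-zero {zero}  f eq = refl
sum-zero {suc n} f eq = cong₂ _+_ (eq zero) (sum-zero (f ∘ suc) (eq ∘ suc))

sum-mono-≤ : ∀ {n} (f g : Fin n → ℕ) → (∀ i → f i ≤ g i) → sum f ≤ sum g
sum-mono-≤ {zero}  f g le = z≤n
sum-mono-≤ {suc n} f g le = ℕ.+-mono-≤ (le zero) (sum-mono-≤ (f ∘ suc) (g ∘ suc) (le ∘ suc))

sum-mono-< : ∀ {n} (f g : Fin n → ℕ) → (∀ i → f i ≤ g i) → ∀ i → f i < g i → sum f < sum g
sum-mono-< f g le zero    lt = ℕ.+-mono-<-≤ lt (sum-mono-≤ (f ∘ suc) (g ∘ suc) (le ∘ suc))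
sum-mono-< f g le (suc i) lt = ℕ.+-mono-≤-< (le zero) (sum-mono-< (f ∘ suc) (g ∘ suc) (le ∘ suc) i lt)

sum-ones : ∀ n → sum {n} (λ _ → 1) ≡ n
sum-ones zero    = refl
sum-ones (suc n) = cong suc (sum-ones n)

sum-pos : ∀ {n} (f : Fin n → ℕ) → 0 < sum f → ∃ λ i → 0 < f i
sum-pos {suc n} f lt with f zero in eq
... | suc _ = zero , subst (0 <_) (sym eq) (s≤s z≤n)
... | zero with sum-pos (f ∘ suc) lt
... | i , p = suc i , p

sum-split : ∀ a {b} (f : Fin (a + b) → ℕ) → sum f ≡ sum (f ∘ (_↑ˡ b)) + sum (f ∘ (a ↑ʳ_))
sum-split zero    f = refl
sum-split (suc a) f = trans (cong (λ t → f zero + t) (sum-split a (f ∘ suc))) (sym (ℕ.+-assoc (f zero) _ _))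

-- Sums over natural numbers rather than `Fin n`, so that a column height or a sum of heights can
-- serve as the bound and a shift of the index is plain arithmetic.
S : ℕ → (ℕ → ℕ) → ℕ
S zero    f = 0
S (suc n) f = f 0 + S n (f ∘ suc)

sum-toℕ : ∀ n (f : ℕ → ℕ) → sum {n} (f ∘ toℕ) ≡ S n f
sum-toℕ zero    f = refl
sum-toℕ (suc n) f = cong (λ t → f 0 + t) (sum-toℕ n (f ∘ suc))

S-cong : ∀ n {f g : ℕ → ℕ} → (∀ i → i < n → f i ≡ g i) → S n f ≡ S n g
S-cong zero    eq = refl
S-cong (suc n) eq = cong₂ _+_ (eq 0 (s≤s z≤n)) (S-cong n (λ i lt → eq (suc i) (s≤s lt)))

S-zero : ∀ n {f : ℕ → ℕ} → (∀ i → i < n → f i ≡ 0) → S n f ≡ 0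
S-zero zero    eq = refl
S-zero (suc n) eq = cong₂ _+_ (eq 0 (s≤s z≤n)) (S-zero n (λ i lt → eq (suc i) (s≤s lt)))

S-distrib-+ : ∀ n (f g : ℕ → ℕ) → S n (λ i → f i + g i) ≡ S n f + S n g
S-distrib-+ n f g = trans (sym (sum-toℕ n _))
  (trans (∑-distrib-+ {n} (f ∘ toℕ) (g ∘ toℕ)) (cong₂ _+_ (sum-toℕ n f) (sum-toℕ n g)))

S-comm : ∀ m n (f : ℕ → ℕ → ℕ) → S m (λ i → S n (f i)) ≡ S n (λ j → S m (λ i → f i j))
S-comm zero    n f = sym (S-zero n (λ _ _ → refl))
S-comm (suc m) n f = trans (cong (λ t → S n (f 0) + t) (S-comm m n (f ∘ suc))) (sym (S-distrib-+ n (f 0) _))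

S-split : ∀ a b (f : ℕ → ℕ) → S (a + b) f ≡ S a f + S b (λ i → f (a + i))
S-split zero    b f = refl
S-split (suc a) b f = trans (cong (λ t → f 0 + t) (S-split a b (f ∘ suc))) (sym (ℕ.+-assoc (f 0) _ _))

S-last : ∀ n (f : ℕ → ℕ) → S (suc n) f ≡ S n f + f n
S-last zero    f = ℕ.+-comm (f 0) 0
S-last (suc n) f = trans (cong (λ t → f 0 + t) (S-last n (f ∘ suc))) (sym (ℕ.+-assoc (f 0) _ _))

-- Telescoping without subtraction: the two sums differ by `f 0` against `f n`.
S-shift : ∀ n (f : ℕ → ℕ) → f 0 ≡ f n → S n f ≡ S n (f ∘ suc)
S-shift n f eq = ℕ.+-cancelʳ-≡ (f n) (S n f) (S n (f ∘ suc))
  (trans (sym (S-last n f)) (trans (ℕ.+-comm (f 0) _) (cong (λ t → S n (f ∘ suc) + t) eq)))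

S-+-const : ∀ n c (f : ℕ → ℕ) → S n (λ i → f i + c) ≡ S n f + n * c
S-+-const zero    c f = refl
S-+-const (suc n) c f = trans (cong (λ t → f 0 + c + t) (S-+-const n c (f ∘ suc)))
  (lemma (f 0) c (S n (f ∘ suc)) (n * c))
  where
  lemma : ∀ a b c d → a + b + (c + d) ≡ a + c + (b + d)
  lemma = ℕ-solve-∀

S-const : ∀ n c → S n (λ _ → c) ≡ n * c
S-const n c = trans (S-+-const n c (λ _ → 0)) (cong (_+ n * c) (S-zero n (λ _ _ → refl)))

S-mono : ∀ {a b} (f : ℕ → ℕ) → a ≤ b → S a f ≤ S b f
S-mono {a} {b} f le = subst (λ b → S a f ≤ S b f) (ℕ.m+[n∸m]≡n le)
  (ℕ.≤-trans (ℕ.m≤m+n _ _) (ℕ.≤-reflexive (sym (S-split a (b ∸ a) f))))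

S-δ : ∀ n c (f : ℕ → ℕ) → c < n → S n (λ x → ⟦ c ≟ x ⟧ * f x) ≡ f c
S-δ (suc n) zero    f lt = trans (cong₂ _+_ (ℕ.+-identityʳ (f 0)) (S-zero n (λ _ _ → refl))) (ℕ.+-identityʳ (f 0))
S-δ (suc n) (suc c) f (s≤s lt) = S-δ n c (f ∘ suc) lt

S-⟦<⟧ : ∀ m a → a ≤ m → S m (λ x → ⟦ x <? a ⟧) ≡ a
S-⟦<⟧ m zero le = S-zero m (λ _ _ → refl)
S-⟦<⟧ (suc m) (suc a) (s≤s le) = cong suc (S-⟦<⟧ m a le)

-- With `h` the column heights, each row of the grid contains exactly one north step. This groups
-- the rows by the column of that step.
S-blocks : ∀ m (h f : ℕ → ℕ) → S (S m h) f ≡ S m (λ x → S (h x) (λ j → f (S x h + j)))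
S-blocks zero    h f = refl
S-blocks (suc m) h f = begin
  S (S (suc m) h) f                    ≡⟨ cong (λ k → S k f) (S-last m h) ⟩
  S (S m h + h m) f                    ≡⟨ S-split (S m h) (h m) f ⟩
  S (S m h) f + block m                ≡⟨ cong (_+ block m) (S-blocks m h f) ⟩
  S m block + block m                  ≡⟨ S-last m block ⟨
  S (suc m) block                      ∎
  where
  open ≡-Reasoning
  block : ℕ → ℕ
  block x = S (h x) (λ j → f (S x h + j))

-- Turns a sum over ordered pairs of columns into one over pairs `p < q` together with the diagonal,
-- the form in which attacks and contacts can be compared for a fixed `q`.
S-triangle : ∀ m (G : ℕ → ℕ → ℕ) →
  S m (λ x → S m (G x)) ≡ S m (λ q → S q (λ p → G p q + G q p) + G q q)
S-triangle zero    G = refl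
S-triangle (suc m) G = begin
  S (suc m) (λ x → S (suc m) (G x))
    ≡⟨ S-last m _ ⟩
  S m (λ x → S (suc m) (G x)) + S (suc m) (G m)
    ≡⟨ cong₂ _+_ (trans (S-cong m (λ x _ → S-last m (G x))) (S-distrib-+ m _ _)) (S-last m (G m)) ⟩
  (S m (λ x → S m (G x)) + S m (λ x → G x m)) + (S m (G m) + G m m)
    ≡⟨ lemma (S m (λ x → S m (G x))) (S m (λ x → G x m)) (S m (G m)) (G m m) ⟩
  S m (λ x → S m (G x)) + ((S m (λ x → G x m) + S m (G m)) + G m m)
    ≡⟨ cong₂ _+_ (S-triangle m G) (cong (_+ G m m) (sym (S-distrib-+ m _ _))) ⟩
  S m row + row m
    ≡⟨ S-last m row ⟨
  S (suc m) row ∎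
  where
  open ≡-Reasoning
  row : ℕ → ℕ
  row q = S q (λ p → G p q + G q p) + G q q
  lemma : ∀ a b c d → (a + b) + (c + d) ≡ a + ((b + c) + d)
  lemma = ℕ-solve-∀

count-tabulate : ∀ {A : Set} {n} (p : A → Bool) (f : Fin n → A) →
  count p (List.tabulate f) ≡ sum (λ i → if p (f i) then 1 else 0)
count-tabulate {n = zero}  p f = refl
count-tabulate {n = suc n} p f = cong (λ t → (if p (f zero) then 1 else 0) + t) (count-tabulate p (f ∘ suc))

count-applyUpTo : ∀ {A : Set} n (p : A → Bool) (f : ℕ → A) →
  count p (applyUpTo f n) ≡ S n (λ i → if p (f i) then 1 else 0)
count-applyUpTo zero    p f = refl
count-applyUpTo (suc n) p f = cong (λ t → (if p (f 0) then 1 else 0) + t) (count-applyUpTo n p (f ∘ suc))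

count-toList : ∀ {A : Set} {n} (p : A → Bool) (v : Vec A n) →
  count p (toList v) ≡ sum (λ i → if p (lookup v i) then 1 else 0)
count-toList p Vec.[]      = refl
count-toList p (a Vec.∷ v) = cong (λ t → (if p a then 1 else 0) + t) (count-toList p v)

foldr-map-tabulate : ∀ {A : Set} {n} (g : A → ℕ) (f : Fin n → A) →
  List.foldr _+_ 0 (List.map g (List.tabulate f)) ≡ sum (g ∘ f)
foldr-map-tabulate {n = zero}  g f = refl
foldr-map-tabulate {n = suc n} g f = cong (λ t → g (f zero) + t) (foldr-map-tabulate g (f ∘ suc))

-- The pdinv identity

-- Reduces every transfer of an inequality between integers to an equation of differences, which the
-- ring solver can settle.
<ℤ-by : ∀ {a b c d : ℤ} → a ℤ.< b → b ℤ.- a ≡ d ℤ.- c → c ℤ.< d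
<ℤ-by {a} {b} {c} {d} lt eq = subst₂ ℤ._<_ (lemma₁ a c)
  (trans (cong (λ x → x ℤ.+ c) eq) (lemma₂ c d)) (ℤ.+-monoˡ-< c (ℤ.+-monoˡ-< (ℤ.- a) lt))
  where
  lemma₁ : ∀ a c → (a ℤ.- a) ℤ.+ c ≡ c
  lemma₁ = ℤ-solve-∀
  lemma₂ : ∀ c d → (d ℤ.- c) ℤ.+ c ≡ d
  lemma₂ = ℤ-solve-∀

≤ℤ-by : ∀ {a b c d : ℤ} → a ℤ.≤ b → b ℤ.- a ≡ d ℤ.- c → c ℤ.≤ d
≤ℤ-by {a} {b} {c} {d} le eq = subst₂ ℤ._≤_ (lemma₁ a c)
  (trans (cong (λ x → x ℤ.+ c) eq) (lemma₂ c d)) (ℤ.+-monoˡ-≤ c (ℤ.+-monoˡ-≤ (ℤ.- a) le))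
  where
  lemma₁ : ∀ a c → (a ℤ.- a) ℤ.+ c ≡ c
  lemma₁ = ℤ-solve-∀
  lemma₂ : ∀ c d → (d ℤ.- c) ℤ.+ c ≡ d
  lemma₂ = ℤ-solve-∀

≤ℤ+ : ∀ a k → a ℤ.≤ a ℤ.+ + k
≤ℤ+ a k = ℤ.i≤i+j a (+ k)

-- b x and β x stand for the rank of the lowest cell of column x without and with its tie-breaking term.
-- meet counts the cells entering pdinv, stretchedMeet those of the stretched path; above and sub count
-- the attacks by upper cells and by bottom cells on the bottom cell of the stretched path.
module Lattice (m n : ℕ) (h : ℕ → ℕ) (b β : ℕ → ℤ)
  (b-zero : b 0 ≡ 0ℤ)
  (b-suc : ∀ x → b (suc x) ℤ.+ + n ≡ b x ℤ.+ + h x ℤ.* + m)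
  (b-nonneg : ∀ x → x < m → 0ℤ ℤ.≤ b x)
  (b<⇒β< : ∀ p q → p < q → q < m → ∀ k → b q ℤ.+ + k ℤ.* + m ℤ.< b p → β q ℤ.+ + k ℤ.* + m ℤ.< β p)
  (b≤⇒β≤ : ∀ p q → p < q → q < m → ∀ k → b p ℤ.≤ b q ℤ.+ + k ℤ.* + m → β p ℤ.≤ β q ℤ.+ + k ℤ.* + m)
  (b<⇒β<′ : ∀ p q → p < q → q < m → ∀ k → b q ℤ.< b p ℤ.+ + k ℤ.* + m → β q ℤ.< β p ℤ.+ + k ℤ.* + m)
  (b≤⇒β≤′ : ∀ p q → p < q → q < m → ∀ k → b p ℤ.+ + k ℤ.* + m ℤ.≤ b q → β p ℤ.+ + k ℤ.* + m ℤ.≤ β q)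
  (β-distinct : ∀ p q → p < m → q < m → p ≢ q → ∀ k → β p ≢ β q ℤ.+ + k ℤ.* + m)
  where

  infixl 6 _⊕_
  _⊕_ : ℤ → ℕ → ℤ
  a ⊕ k = a ℤ.+ + k ℤ.* + m

  ⊕-zero : ∀ a → a ⊕ 0 ≡ a
  ⊕-zero a = trans (cong (λ x → a ℤ.+ x) (ℤ.*-zeroˡ (+ m))) (ℤ.+-identityʳ a)

  ⊕-suc : ∀ a k → a ⊕ suc k ≡ a ⊕ k ℤ.+ + m
  ⊕-suc a k = lemma a (+ k) (+ m)
    where
    lemma : ∀ a k m → a ℤ.+ (1ℤ ℤ.+ k) ℤ.* m ≡ a ℤ.+ k ℤ.* m ℤ.+ m
    lemma = ℤ-solve-∀

  ⊕-one : ∀ a → a ⊕ 1 ≡ a ℤ.+ + m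
  ⊕-one a = trans (⊕-suc a 0) (cong (λ x → x ℤ.+ + m) (⊕-zero a))

  ⊕-≤-suc : ∀ a k → a ⊕ k ℤ.≤ a ⊕ suc k
  ⊕-≤-suc a k = subst (a ⊕ k ℤ.≤_) (sym (⊕-suc a k)) (≤ℤ+ (a ⊕ k) m)

  ≤-⊕ : ∀ a k → a ℤ.≤ a ⊕ k
  ≤-⊕ a zero    = ℤ.≤-reflexive (sym (⊕-zero a))
  ≤-⊕ a (suc k) = ℤ.≤-trans (≤-⊕ a k) (⊕-≤-suc a k)

  -- Consecutive intervals of length `m` tile the long interval except for their common endpoints,
  -- and `c` avoids these.
  S-intervals : ∀ a c k → (∀ j → c ≢ a ⊕ j) →
    S k (λ j → ⟦ (a ⊕ j ℤ.<? c) ×-dec (c ℤ.<? a ⊕ suc j) ⟧) ≡ ⟦ (a ℤ.<? c) ×-dec (c ℤ.<? a ⊕ k) ⟧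
  S-intervals a c zero ne =
    sym (⟦⟧-no ((a ℤ.<? c) ×-dec (c ℤ.<? a ⊕ 0))
      (λ (lt , lt′) → ℤ.<-asym lt (subst (c ℤ.<_) (⊕-zero a) lt′)))
  S-intervals a c (suc k) ne = begin
    S (suc k) step                                        ≡⟨ S-last k step ⟩
    S k step + step k                                     ≡⟨ cong (_+ step k) (S-intervals a c k ne) ⟩
    ⟦ (a ℤ.<? c) ×-dec (c ℤ.<? a ⊕ k) ⟧ + step k
      ≡⟨ ⟦⟧-⊎ ((a ℤ.<? c) ×-dec (c ℤ.<? a ⊕ suc k)) ((a ℤ.<? c) ×-dec (c ℤ.<? a ⊕ k)) ((a ⊕ k ℤ.<? c) ×-dec (c ℤ.<? a ⊕ suc k))
          split
          (λ (lt , lt′) → lt , ℤ.<-≤-trans lt′ (⊕-≤-suc a k))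
          (λ (lt , lt′) → ℤ.≤-<-trans (≤-⊕ a k) lt , lt′)
          (λ (_ , lt) (lt′ , _) → ℤ.<-asym lt lt′) ⟨
    ⟦ (a ℤ.<? c) ×-dec (c ℤ.<? a ⊕ suc k) ⟧               ∎
    where
    open ≡-Reasoning
    step : ℕ → ℕ
    step j = ⟦ (a ⊕ j ℤ.<? c) ×-dec (c ℤ.<? a ⊕ suc j) ⟧
    split : a ℤ.< c × c ℤ.< a ⊕ suc k → (a ℤ.< c × c ℤ.< a ⊕ k) ⊎ (a ⊕ k ℤ.< c × c ℤ.< a ⊕ suc k)
    split (lt , lt′) with c ℤ.<? a ⊕ k
    ... | yes p = inj₁ (lt , p)
    ... | no ¬p = inj₂ (ℤ.≤∧≢⇒< (ℤ.≮⇒≥ ¬p) (λ eq → ne k (sym eq)) , lt′)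

  meet stretchedMeet above sub : ℕ → ℕ → ℕ
  meet p q = S (h q) (λ j → ⟦ (b (suc p) ℤ.≤? b q ⊕ suc j) ×-dec (b q ⊕ j ℤ.<? b (suc p) ℤ.+ + n) ⟧)
  stretchedMeet p q = S (suc (h q)) (λ j →
    ⟦ (b (suc p) ℤ.≤? b q ⊕ suc j) ×-dec (b q ⊕ j ℤ.<? b (suc p) ℤ.+ + n ℤ.+ + m) ⟧)
  above p q = S (h q) (λ j → ⟦ (β q ⊕ suc j ℤ.<? β p) ×-dec (β p ℤ.<? β q ⊕ suc (suc j)) ⟧)
  sub p q = ⟦ (β p ℤ.<? β q) ×-dec (β q ℤ.<? β p ℤ.+ + m) ⟧

  private
    -- `above` with levels in place of ranks. The upper bound is weak because, for `p < q`, a tie of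
    -- levels ranks column `p` below column `q`.
    aboveᵇ : ℕ → ℕ → ℕ
    aboveᵇ p q = S (h q) (λ j → ⟦ (b q ⊕ suc j ℤ.<? b p) ×-dec (b p ℤ.≤? b q ⊕ suc (suc j)) ⟧)

    low : ℕ → ℕ → ℕ
    low p q = ⟦ b p ℤ.≤? b q ⊕ 1 ⟧

    -- The two thresholds are separate arguments so that one can move without the other.
    -- `mid (suc p) (suc p) q` is the contact of the east step over `p` with the new bottom step of
    -- column `q`; `mid p (suc p) q` will turn out to count attacks between columns `p` and `q`.
    mid : ℕ → ℕ → ℕ → ℕ
    mid p r q = ⟦ (b p ℤ.≤? b q ⊕ 1) ×-dec (b q ℤ.<? b r ℤ.+ + n ℤ.+ + m) ⟧

    -- The term `j = 0` is the new bottom step. For the step `suc j`, the strict bound is that of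
    -- the old step `j` with `m` added to both sides, whereas the weak bound is relaxed by `m`. The
    -- relaxation admits exactly the pairs of `aboveᵇ (suc p) q`, for which the strict bound is
    -- automatic.
    stretch : ∀ p q → stretchedMeet p q ≡ mid (suc p) (suc p) q + (meet p q + aboveᵇ (suc p) q)
    stretch p q = cong₂ _+_ first (trans (S-cong (h q) (λ j _ → later j)) (S-distrib-+ (h q) _ _))
      where
      b′ = b (suc p)
      first : ⟦ (b′ ℤ.≤? b q ⊕ 1) ×-dec (b q ⊕ 0 ℤ.<? b′ ℤ.+ + n ℤ.+ + m) ⟧ ≡ mid (suc p) (suc p) q
      first rewrite ⊕-zero (b q) = refl
      +m-cancel : ∀ j → b q ⊕ suc j ℤ.< b′ ℤ.+ + n ℤ.+ + m → b q ⊕ j ℤ.< b′ ℤ.+ + n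
      +m-cancel j lt = <ℤ-by (subst (ℤ._< b′ ℤ.+ + n ℤ.+ + m) (⊕-suc (b q) j) lt) (lemma (b q ⊕ j) (b′ ℤ.+ + n) (+ m))
        where
        lemma : ∀ x y z → (y ℤ.+ z) ℤ.- (x ℤ.+ z) ≡ y ℤ.- x
        lemma = ℤ-solve-∀
      later : ∀ j → ⟦ (b′ ℤ.≤? b q ⊕ suc (suc j)) ×-dec (b q ⊕ suc j ℤ.<? b′ ℤ.+ + n ℤ.+ + m) ⟧
            ≡ ⟦ (b′ ℤ.≤? b q ⊕ suc j) ×-dec (b q ⊕ j ℤ.<? b′ ℤ.+ + n) ⟧
            + ⟦ (b q ⊕ suc j ℤ.<? b′) ×-dec (b′ ℤ.≤? b q ⊕ suc (suc j)) ⟧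
      later j = ⟦⟧-⊎
        ((b′ ℤ.≤? b q ⊕ suc (suc j)) ×-dec (b q ⊕ suc j ℤ.<? b′ ℤ.+ + n ℤ.+ + m))
        ((b′ ℤ.≤? b q ⊕ suc j) ×-dec (b q ⊕ j ℤ.<? b′ ℤ.+ + n))
        ((b q ⊕ suc j ℤ.<? b′) ×-dec (b′ ℤ.≤? b q ⊕ suc (suc j)))
        split
        (λ (le , lt) → ℤ.≤-trans le (⊕-≤-suc (b q) (suc j)) ,
          subst (ℤ._< b′ ℤ.+ + n ℤ.+ + m) (sym (⊕-suc (b q) j)) (ℤ.+-monoˡ-< (+ m) lt))
        (λ (lt , le) → le , ℤ.<-≤-trans lt (ℤ.≤-trans (≤ℤ+ b′ n) (≤ℤ+ (b′ ℤ.+ + n) m)))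
        (λ (le , _) (lt , _) → ℤ.<⇒≱ lt le)
        where
        split : b′ ℤ.≤ b q ⊕ suc (suc j) × b q ⊕ suc j ℤ.< b′ ℤ.+ + n ℤ.+ + m →
                (b′ ℤ.≤ b q ⊕ suc j × b q ⊕ j ℤ.< b′ ℤ.+ + n) ⊎ (b q ⊕ suc j ℤ.< b′ × b′ ℤ.≤ b q ⊕ suc (suc j))
        split (le , lt) with b′ ℤ.≤? b q ⊕ suc j
        ... | yes le′ = inj₁ (le′ , +m-cancel j lt)
        ... | no  gt  = inj₂ (ℤ.≰⇒> gt , le)

    aboveᵇ-vanish : ∀ p q → b p ℤ.≤ b q → aboveᵇ p q ≡ 0
    aboveᵇ-vanish p q le = S-zero (h q) (λ j _ →
      ⟦⟧-no ((b q ⊕ suc j ℤ.<? b p) ×-dec (b p ℤ.≤? b q ⊕ suc (suc j)))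
        (λ (lt , _) → ℤ.<⇒≱ lt (ℤ.≤-trans le (≤-⊕ (b q) (suc j)))))

    -- Both end terms vanish: an upper cell of column `q` lies above level `b q`, which is at least
    -- `b 0 = 0` by the Dyck condition.
    aboveᵇ-shift : ∀ q → q < m → S q (λ p → aboveᵇ (suc p) q) ≡ S q (λ p → aboveᵇ p q)
    aboveᵇ-shift q q<m = sym (S-shift q (λ p → aboveᵇ p q)
      (trans (aboveᵇ-vanish 0 q (subst (ℤ._≤ b q) (sym b-zero) (b-nonneg q q<m)))
             (sym (aboveᵇ-vanish q q ℤ.≤-refl))))

    aboveᵇ≡above : ∀ p q → p < q → q < m → aboveᵇ p q ≡ above p q
    aboveᵇ≡above p q p<q q<m = S-cong (h q) (λ j _ → ⟦⟧-cong
      ((b q ⊕ suc j ℤ.<? b p) ×-dec (b p ℤ.≤? b q ⊕ suc (suc j)))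
      ((β q ⊕ suc j ℤ.<? β p) ×-dec (β p ℤ.<? β q ⊕ suc (suc j)))
      (λ (lt , le) → b<⇒β< p q p<q q<m (suc j) lt ,
        ℤ.≤∧≢⇒< (b≤⇒β≤ p q p<q q<m (suc (suc j)) le) (ne (suc (suc j))))
      (λ (lt , lt′) → ℤ.≰⇒> (λ le → ℤ.<⇒≱ lt (b≤⇒β≤ p q p<q q<m (suc j) le)) ,
        ℤ.≮⇒≥ (λ gt → ℤ.<-asym lt′ (b<⇒β< p q p<q q<m (suc (suc j)) gt))))
      where
      ne : ∀ k → β p ≢ β q ⊕ k
      ne = β-distinct p q (ℕ.<-trans p<q q<m) q<m (ℕ.<⇒≢ p<q)

    -- `above q p` and `sub p q` together are the attacks of all cells of the stretched column `p`
    -- on the bottom cell of `q`. Their intervals are consecutive, so they amount to `β q` lying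
    -- between `β p` and `β p ⊕ suc (h p)`. The reverse attack `sub q p` extends this range downward
    -- by `m`. Passing to levels makes the lower end weak, and `b-suc` expresses the upper end by
    -- column `suc p`.
    below≡mid : ∀ p q → p < q → q < m → above q p + (sub p q + sub q p) ≡ mid p (suc p) q
    below≡mid p q p<q q<m = begin
      above q p + (sub p q + sub q p)
        ≡⟨ lemma (above q p) (sub p q) (sub q p) ⟩
      (sub p q + above q p) + sub q p
        ≡⟨ cong (_+ sub q p) (trans (cong (_+ above q p) (sub-step)) (S-intervals (β p) (β q) (suc (h p)) ne′)) ⟩
      ⟦ (β p ℤ.<? β q) ×-dec (β q ℤ.<? β p ⊕ suc (h p)) ⟧ + sub q p
        ≡⟨ ⟦⟧-⊎ ((β p ℤ.<? β q ⊕ 1) ×-dec (β q ℤ.<? β p ⊕ suc (h p)))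
            ((β p ℤ.<? β q) ×-dec (β q ℤ.<? β p ⊕ suc (h p)))
            ((β q ℤ.<? β p) ×-dec (β p ℤ.<? β q ℤ.+ + m))
            split
            (λ (lt , lt′) → ℤ.<-≤-trans lt (≤-⊕ (β q) 1) , lt′)
            (λ (lt , lt′) → subst (β p ℤ.<_) (sym (⊕-one (β q))) lt′ , ℤ.<-≤-trans lt (≤-⊕ (β p) (suc (h p))))
            (λ (lt , _) (lt′ , _) → ℤ.<-asym lt lt′) ⟨
      ⟦ (β p ℤ.<? β q ⊕ 1) ×-dec (β q ℤ.<? β p ⊕ suc (h p)) ⟧
        ≡⟨ ⟦⟧-cong ((β p ℤ.<? β q ⊕ 1) ×-dec (β q ℤ.<? β p ⊕ suc (h p)))
            ((b p ℤ.≤? b q ⊕ 1) ×-dec (b q ℤ.<? b p ⊕ suc (h p)))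
            (λ (lt , lt′) → ℤ.≮⇒≥ (λ gt → ℤ.<-asym lt (b<⇒β< p q p<q q<m 1 gt)) ,
              ℤ.≰⇒> (λ le → ℤ.<⇒≱ lt′ (b≤⇒β≤′ p q p<q q<m (suc (h p)) le)))
            (λ (le , lt) → ℤ.≤∧≢⇒< (b≤⇒β≤ p q p<q q<m 1 le) (ne 1) , b<⇒β<′ p q p<q q<m (suc (h p)) lt) ⟩
      ⟦ (b p ℤ.≤? b q ⊕ 1) ×-dec (b q ℤ.<? b p ⊕ suc (h p)) ⟧
        ≡⟨ cong (λ c → ⟦ (b p ℤ.≤? b q ⊕ 1) ×-dec (b q ℤ.<? c) ⟧)
            (trans (⊕-suc (b p) (h p)) (cong (λ x → x ℤ.+ + m) (sym (b-suc p)))) ⟩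
      mid p (suc p) q ∎
      where
      open ≡-Reasoning
      lemma : ∀ x y z → x + (y + z) ≡ (y + x) + z
      lemma = ℕ-solve-∀
      ne : ∀ k → β p ≢ β q ⊕ k
      ne = β-distinct p q (ℕ.<-trans p<q q<m) q<m (ℕ.<⇒≢ p<q)
      ne′ : ∀ k → β q ≢ β p ⊕ k
      ne′ = β-distinct q p q<m (ℕ.<-trans p<q q<m) (ℕ.>⇒≢ p<q)
      sub-step : sub p q ≡ ⟦ (β p ⊕ 0 ℤ.<? β q) ×-dec (β q ℤ.<? β p ⊕ 1) ⟧
      sub-step rewrite ⊕-zero (β p) | ⊕-one (β p) = refl
      split : β p ℤ.< β q ⊕ 1 × β q ℤ.< β p ⊕ suc (h p) →
        (β p ℤ.< β q × β q ℤ.< β p ⊕ suc (h p)) ⊎ (β q ℤ.< β p × β p ℤ.< β q ℤ.+ + m)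
      split (lt , lt′) with β p ℤ.<? β q
      ... | yes r = inj₁ (r , lt′)
      ... | no ¬r = inj₂ (ℤ.≤∧≢⇒< (ℤ.≮⇒≥ ¬r) (λ eq → ne′ 0 (trans eq (sym (⊕-zero (β p)))))
                         , subst (β p ℤ.<_) (⊕-one (β q)) lt)

    -- b drops by at most n per step, so it cannot jump across the middle band.
    mid-low : ∀ p q → mid p (suc p) q + low (suc p) q ≡ mid (suc p) (suc p) q + low p q
    mid-low p q with b p ℤ.≤? b q ⊕ 1 | b (suc p) ℤ.≤? b q ⊕ 1 | b q ℤ.<? b (suc p) ℤ.+ + n ℤ.+ + m
    ... | yes _ | yes _ | _     = refl
    ... | yes _ | no _  | yes _ = refl
    ... | no _  | yes _ | yes _ = refl
    ... | no _  | no _  | _     = refl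
    ... | yes _ | no gt | no ge = contradiction
      (ℤ.≤-<-trans (≤-⊕ (b q) 1) (ℤ.<-≤-trans (ℤ.≰⇒> gt)
        (ℤ.≤-trans (≤ℤ+ (b (suc p)) n) (≤ℤ+ (b (suc p) ℤ.+ + n) m)))) ge
    ... | no gt | yes _ | no ge = contradiction
      (ℤ.≤-<-trans (≤-⊕ (b q) 1) (ℤ.<-≤-trans (ℤ.≰⇒> gt)
        (ℤ.≤-trans (≤-⊕ (b p) (h p)) (ℤ.≤-trans (ℤ.≤-reflexive (sym (b-suc p))) (≤ℤ+ (b (suc p) ℤ.+ + n) m))))) ge

    -- By `mid-low` the two sides differ by a telescoping sum of `low`, whose value is `1` at both
    -- ends.
    mid-shift : ∀ q → q < m → S q (λ p → mid p (suc p) q) ≡ S q (λ p → mid (suc p) (suc p) q)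
    mid-shift q q<m = ℕ.+-cancelʳ-≡ (S q (λ p → low (suc p) q)) _ _ (begin
      S q (λ p → mid p (suc p) q) + S q (λ p → low (suc p) q)
        ≡⟨ S-distrib-+ q _ _ ⟨
      S q (λ p → mid p (suc p) q + low (suc p) q)
        ≡⟨ S-cong q (λ p _ → mid-low p q) ⟩
      S q (λ p → mid (suc p) (suc p) q + low p q)
        ≡⟨ S-distrib-+ q _ _ ⟩
      S q (λ p → mid (suc p) (suc p) q) + S q (λ p → low p q)
        ≡⟨ cong (λ t → S q (λ p → mid (suc p) (suc p) q) + t) (S-shift q (λ p → low p q) (trans low-zero (sym low-self))) ⟩
      S q (λ p → mid (suc p) (suc p) q) + S q (λ p → low (suc p) q) ∎)
      where
      open ≡-Reasoning
      low-zero : low 0 q ≡ 1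
      low-zero = ⟦⟧-yes (b 0 ℤ.≤? b q ⊕ 1)
        (ℤ.≤-trans (subst (ℤ._≤ b q) (sym b-zero) (b-nonneg q q<m)) (≤-⊕ (b q) 1))
      low-self : low q q ≡ 1
      low-self = ⟦⟧-yes (b q ℤ.≤? b q ⊕ 1) (≤-⊕ (b q) 1)

  -- New contacts of the east step over `p` are governed by the level of column `suc p`, attacks by
  -- that of column `p`. The two are reconciled only by summing over all `p < q`, not pair by pair.
  stretched-row : ∀ q → q < m →
    S q (λ p → stretchedMeet p q) ≡
    S q (λ p → meet p q) + S q (λ p → (above p q + sub p q) + (above q p + sub q p))
  stretched-row q q<m = begin
    S q (λ p → stretchedMeet p q)
      ≡⟨ trans (S-cong q (λ p _ → stretch p q)) (S-distrib-+ q _ _) ⟩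
    S q (λ p → mid (suc p) (suc p) q) + S q (λ p → meet p q + aboveᵇ (suc p) q)
      ≡⟨ cong₂ _+_ (sym (mid-shift q q<m)) (S-distrib-+ q _ _) ⟩
    S q (λ p → mid p (suc p) q) + (S q (λ p → meet p q) + S q (λ p → aboveᵇ (suc p) q))
      ≡⟨ cong₂ (λ s t → s + (S q (λ p → meet p q) + t))
          (S-cong q (λ p p<q → sym (below≡mid p q p<q q<m)))
          (trans (aboveᵇ-shift q q<m) (S-cong q (λ p p<q → aboveᵇ≡above p q p<q q<m))) ⟩
    S q (λ p → above q p + (sub p q + sub q p)) + (S q (λ p → meet p q) + S q (λ p → above p q))
      ≡⟨ lemma (S q (λ p → above q p + (sub p q + sub q p))) (S q (λ p → meet p q)) (S q (λ p → above p q)) ⟩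
    S q (λ p → meet p q) + (S q (λ p → above q p + (sub p q + sub q p)) + S q (λ p → above p q))
      ≡⟨ cong (λ t → S q (λ p → meet p q) + t) (trans (sym (S-distrib-+ q _ _))
          (S-cong q (λ p _ → lemma₂ (above q p) (sub p q) (sub q p) (above p q)))) ⟩
    S q (λ p → meet p q) + S q (λ p → (above p q + sub p q) + (above q p + sub q p)) ∎
    where
    open ≡-Reasoning
    lemma : ∀ x y z → x + (y + z) ≡ y + (x + z)
    lemma = ℕ-solve-∀
    lemma₂ : ∀ x y z w → x + (y + z) + w ≡ (w + y) + (x + z)
    lemma₂ = ℕ-solve-∀

-- Ranks

divN≡/ : ∀ a m .{{_ : NonZero m}} → divN a m ≡ a / m
divN≡/ a (suc m) = refl

instance
  gcd-nonZero : ∀ {m n} .{{_ : NonZero m}} → NonZero (gcd m n)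
  gcd-nonZero {suc m} {n} = ≢-nonZero (gcd[m,n]≢0 (suc m) n (inj₁ (λ ())))

-- Stretching thus preserves the floor term of the rank and the number of diagonal points considered
-- by `ret`.
gcd-+ʳ : ∀ m n → gcd m (m + n) ≡ gcd m n
gcd-+ʳ m n = ∣-antisym
  (gcd-greatest (gcd[m,n]∣m m (m + n)) (∣m+n∣m⇒∣n (gcd[m,n]∣n m (m + n)) (gcd[m,n]∣m m (m + n))))
  (gcd-greatest (gcd[m,n]∣m m n) (∣m∣n⇒∣m+n (gcd[m,n]∣m m n) (gcd[m,n]∣n m n)))

tie : ℕ → ℕ → ℕ → ℕ
tie m n x = divN (x * gcd m n) m

tie-mono : ∀ m n .{{_ : NonZero m}} {x y} → x ≤ y → tie m n x ≤ tie m n y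
tie-mono m n {x} {y} le = subst₂ _≤_ (sym (divN≡/ (x * gcd m n) m)) (sym (divN≡/ (y * gcd m n) m))
  (/-monoˡ-≤ m (ℕ.*-monoˡ-≤ (gcd m n) le))

tie<gcd : ∀ m n .{{_ : NonZero m}} x → x < m → tie m n x < gcd m n
tie<gcd m n x lt = subst (_< gcd m n) (sym (divN≡/ (x * gcd m n) m))
  (m<n*o⇒m/o<n (subst (x * gcd m n <_) (ℕ.*-comm m (gcd m n)) (ℕ.*-monoˡ-< (gcd m n) lt)))

module _ (m n : ℕ) .{{_ : NonZero m}} where
  private
    d = gcd m n
    m₀ = m / d
    n₀ = n / d

    m₀d : m₀ * d ≡ m
    m₀d = m/n*n≡m (gcd[m,n]∣m m n)

    n₀d : n₀ * d ≡ n
    n₀d = m/n*n≡m (gcd[m,n]∣n m n)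

  -- Modulo `d` all terms but the ties disappear, and both ties are already reduced.
  tie-mod : ∀ y y′ x x′ → x < m → x′ < m →
    m * y + n * x′ + tie m n x ≡ m * y′ + n * x + tie m n x′ → tie m n x ≡ tie m n x′
  tie-mod y y′ x x′ lt lt′ eq = begin
    tie m n x              ≡⟨ m<n⇒m%n≡m (tie<gcd m n x lt) ⟨
    tie m n x % d          ≡⟨ [m+kn]%n≡m%n (tie m n x) (m₀ * y + n₀ * x′) d ⟨
    (tie m n x + (m₀ * y + n₀ * x′) * d) % d    ≡⟨ cong (_% d) (multiple y x′ (tie m n x)) ⟩
    (m * y + n * x′ + tie m n x) % d            ≡⟨ cong (_% d) eq ⟩
    (m * y′ + n * x + tie m n x′) % d           ≡⟨ cong (_% d) (multiple y′ x (tie m n x′)) ⟨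
    (tie m n x′ + (m₀ * y′ + n₀ * x) * d) % d   ≡⟨ [m+kn]%n≡m%n (tie m n x′) (m₀ * y′ + n₀ * x) d ⟩
    tie m n x′ % d         ≡⟨ m<n⇒m%n≡m (tie<gcd m n x′ lt′) ⟩
    tie m n x′             ∎
    where
    open ≡-Reasoning
    lemma : ∀ t a b y x d → t + (a * y + b * x) * d ≡ (a * d) * y + (b * d) * x + t
    lemma = ℕ-solve-∀
    multiple : ∀ y x t → t + (m₀ * y + n₀ * x) * d ≡ m * y + n * x + t
    multiple y x t = trans (lemma t m₀ n₀ y x d) (cong₂ (λ a b → a * y + b * x + t) m₀d n₀d)

  -- Equal ties confine x and x′ to one window of m₀ consecutive columns, on which
  -- x ↦ n x is injective modulo m.
  column-unique-< : ∀ y y′ x x′ → tie m n x ≡ tie m n x′ → m * y + n * x′ ≡ m * y′ + n * x → ¬ (x < x′)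
  column-unique-< y y′ x x′ same eq x<x′ = ℕ.<⇒≱ z<m₀ (∣⇒≤ {{>-nonZero (ℕ.m<n⇒0<n∸m x<x′)}} m₀∣z)
    where
    z = x′ ∸ x
    q = x * d / m

    x+z : x + z ≡ x′
    x+z = ℕ.m+[n∸m]≡n (ℕ.<⇒≤ x<x′)

    same-quotient : q ≡ x′ * d / m
    same-quotient = trans (sym (divN≡/ (x * d) m)) (trans same (divN≡/ (x′ * d) m))

    zd<m : z * d < m
    zd<m = ℕ.+-cancelˡ-< (x * d) (z * d) m (begin-strict
      x * d + z * d              ≡⟨ ℕ.*-distribʳ-+ d x z ⟨
      (x + z) * d                ≡⟨ cong (_* d) x+z ⟩
      x′ * d                     ≡⟨ m≡m%n+[m/n]*n (x′ * d) m ⟩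
      x′ * d % m + x′ * d / m * m ≡⟨ cong (λ k → x′ * d % m + k * m) same-quotient ⟨
      x′ * d % m + q * m         <⟨ ℕ.+-monoˡ-< (q * m) (m%n<n (x′ * d) m) ⟩
      m + q * m                  ≤⟨ ℕ.+-monoʳ-≤ m (m/n*n≤m (x * d) m) ⟩
      m + x * d                  ≡⟨ ℕ.+-comm m (x * d) ⟩
      x * d + m                  ∎)
      where open ℕ.≤-Reasoning

    z<m₀ : z < m₀
    z<m₀ = ℕ.*-cancelʳ-< d z m₀ (subst (z * d <_) (sym m₀d) zd<m)

    my+nz : m * y + n * z ≡ m * y′
    my+nz = ℕ.+-cancelʳ-≡ (n * x) _ _ (begin
      m * y + n * z + n * x    ≡⟨ lemma (m * y) n z x ⟩
      m * y + n * (x + z)      ≡⟨ cong (λ k → m * y + n * k) x+z ⟩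
      m * y + n * x′           ≡⟨ eq ⟩
      m * y′ + n * x           ∎)
      where
      open ≡-Reasoning
      lemma : ∀ a n z x → a + n * z + n * x ≡ a + n * (x + z)
      lemma = ℕ-solve-∀

    m∣nz : m ∣ n * z
    m∣nz = ∣m+n∣m⇒∣n (subst (m ∣_) (sym my+nz) (m∣m*n y′)) (m∣m*n y)

    m₀∣n₀z : m₀ ∣ n₀ * z
    m₀∣n₀z = *-cancelʳ-∣ d (subst₂ _∣_ (sym m₀d) (trans (cong (_* z) (sym n₀d)) (lemma n₀ d z)) m∣nz)
      where
      lemma : ∀ a d z → a * d * z ≡ a * z * d
      lemma = ℕ-solve-∀

    m₀∣z : m₀ ∣ z
    m₀∣z = coprime-divisor (coprime-/gcd m n) m₀∣n₀z

  rank-injectiveˣ : ∀ y y′ x x′ → x < m → x′ < m → rank m n x y ≡ rank m n x′ y′ → x ≡ x′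
  rank-injectiveˣ y y′ x x′ lt lt′ eq = column-unique
    where
    lemma₁ : ∀ a b b′ f → a ℤ.+ b′ ℤ.+ f ≡ ((a ℤ.- b) ℤ.+ f) ℤ.+ (b ℤ.+ b′)
    lemma₁ = ℤ-solve-∀
    lemma₂ : ∀ a b b′ f → ((a ℤ.- b′) ℤ.+ f) ℤ.+ (b ℤ.+ b′) ≡ a ℤ.+ b ℤ.+ f
    lemma₂ = ℤ-solve-∀
    eqℕ : m * y + n * x′ + tie m n x ≡ m * y′ + n * x + tie m n x′
    eqℕ = ℤ.+-injective (trans (lemma₁ (+ (m * y)) (+ (n * x)) (+ (n * x′)) (+ tie m n x))
      (trans (cong (λ t → t ℤ.+ (+ (n * x) ℤ.+ + (n * x′))) eq)
             (lemma₂ (+ (m * y′)) (+ (n * x)) (+ (n * x′)) (+ tie m n x′))))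
    same : tie m n x ≡ tie m n x′
    same = tie-mod y y′ x x′ lt lt′ eqℕ
    eqxy : m * y + n * x′ ≡ m * y′ + n * x
    eqxy = ℕ.+-cancelʳ-≡ (tie m n x) _ _ (trans eqℕ (cong (λ t → m * y′ + n * x + t) (sym same)))
    column-unique : x ≡ x′
    column-unique with ℕ.<-cmp x x′
    ... | tri< l _ _ = contradiction l (column-unique-< y y′ x x′ same eqxy)
    ... | tri≈ _ e _ = e
    ... | tri> _ _ g = contradiction g (column-unique-< y′ y x′ x (sym same) (sym eqxy))

  module _ (s t : ℤ) (p q : ℕ) (p<q : p < q) (q<m : q < m) where
    tie-≤ : s ℤ.≤ t → s ℤ.+ + tie m n p ℤ.≤ t ℤ.+ + tie m n q
    tie-≤ le = ℤ.+-mono-≤ le (ℤ.+≤+ (tie-mono m n (ℕ.<⇒≤ p<q)))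

    -- Distinct multiples of `d` differ by at least `d`, more than a tie can compensate.
    tie-< : + d ℤ.* s ℤ.< + d ℤ.* t → + d ℤ.* s ℤ.+ + tie m n q ℤ.< + d ℤ.* t ℤ.+ + tie m n p
    tie-< lt = begin-strict
      + d ℤ.* s ℤ.+ + tie m n q    <⟨ ℤ.+-monoʳ-< (+ d ℤ.* s) (ℤ.+<+ (tie<gcd m n q q<m)) ⟩
      + d ℤ.* s ℤ.+ + d            ≡⟨ lemma (+ d) s ⟩
      + d ℤ.* (ℤ.suc s)            ≤⟨ ℤ.*-monoˡ-≤-nonNeg (+ d) (ℤ.i<j⇒suc[i]≤j (ℤ.*-cancelˡ-<-nonNeg (+ d) lt)) ⟩
      + d ℤ.* t                    ≤⟨ ≤ℤ+ _ (tie m n p) ⟩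
      + d ℤ.* t ℤ.+ + tie m n p    ∎
      where
      open ℤ.≤-Reasoning
      lemma : ∀ d s → d ℤ.* s ℤ.+ d ≡ d ℤ.* (1ℤ ℤ.+ s)
      lemma = ℤ-solve-∀

  level : ℕ → ℕ → ℤ
  level x y = + (m * y) ℤ.- + (n * x)

  level-multiple : ∀ x y → level x y ≡ + d ℤ.* (+ (m₀ * y) ℤ.- + (n₀ * x))
  level-multiple x y = begin
    + (m * y) ℤ.- + (n * x)
      ≡⟨ cong₂ (λ s t → + s ℤ.- + t) (reassoc m₀ m₀d y) (reassoc n₀ n₀d x) ⟩
    + (d * (m₀ * y)) ℤ.- + (d * (n₀ * x))
      ≡⟨ cong₂ ℤ._-_ (ℤ.pos-* d (m₀ * y)) (ℤ.pos-* d (n₀ * x)) ⟩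
    + d ℤ.* + (m₀ * y) ℤ.- + d ℤ.* + (n₀ * x)
      ≡⟨ lemma (+ d) (+ (m₀ * y)) (+ (n₀ * x)) ⟩
    + d ℤ.* (+ (m₀ * y) ℤ.- + (n₀ * x)) ∎
    where
    open ≡-Reasoning
    lemma : ∀ d a b → d ℤ.* a ℤ.- d ℤ.* b ≡ d ℤ.* (a ℤ.- b)
    lemma = ℤ-solve-∀
    lemma₂ : ∀ a d y → (a * d) * y ≡ d * (a * y)
    lemma₂ = ℕ-solve-∀
    reassoc : ∀ a {b} → a * d ≡ b → ∀ y → b * y ≡ d * (a * y)
    reassoc a refl y = lemma₂ a d y

  level-+ : ∀ x y k → level x (y + k) ≡ level x y ℤ.+ + k ℤ.* + m
  level-+ x y k = begin
    + (m * (y + k)) ℤ.- + (n * x)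
      ≡⟨ cong (λ t → + t ℤ.- + (n * x)) (lemma₁ m y k) ⟩
    (+ (m * y) ℤ.+ + (k * m)) ℤ.- + (n * x)
      ≡⟨ cong (λ t → (+ (m * y) ℤ.+ t) ℤ.- + (n * x)) (ℤ.pos-* k m) ⟩
    (+ (m * y) ℤ.+ + k ℤ.* + m) ℤ.- + (n * x)
      ≡⟨ lemma₂ (+ (m * y)) (+ k ℤ.* + m) (+ (n * x)) ⟩
    level x y ℤ.+ + k ℤ.* + m ∎
    where
    open ≡-Reasoning
    lemma₁ : ∀ m y k → m * (y + k) ≡ m * y + k * m
    lemma₁ = ℕ-solve-∀
    lemma₂ : ∀ a b c → (a ℤ.+ b) ℤ.- c ≡ (a ℤ.- c) ℤ.+ b
    lemma₂ = ℤ-solve-∀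

  rank-+ : ∀ x y k → rank m n x (y + k) ≡ rank m n x y ℤ.+ + k ℤ.* + m
  rank-+ x y k = trans (cong (λ t → t ℤ.+ + tie m n x) (level-+ x y k))
    (lemma (level x y) (+ k ℤ.* + m) (+ tie m n x))
    where
    lemma : ∀ a b c → (a ℤ.+ b) ℤ.+ c ≡ (a ℤ.+ c) ℤ.+ b
    lemma = ℤ-solve-∀

  level<⇒rank< : ∀ p q → p < q → q < m → ∀ y y′ → level q y ℤ.< level p y′ → rank m n q y ℤ.< rank m n p y′
  level<⇒rank< p q p<q q<m y y′ lt = subst₂ (λ s t → s ℤ.+ + tie m n q ℤ.< t ℤ.+ + tie m n p)
    (sym (level-multiple q y)) (sym (level-multiple p y′))
    (tie-< _ _ p q p<q q<m (subst₂ ℤ._<_ (level-multiple q y) (level-multiple p y′) lt))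

  level≤⇒rank≤ : ∀ p q → p < q → q < m → ∀ y y′ → level p y ℤ.≤ level q y′ → rank m n p y ℤ.≤ rank m n q y′
  level≤⇒rank≤ p q p<q q<m y y′ = tie-≤ (level p y) (level q y′) p q p<q q<m

  module _ (h : ℕ → ℕ) where
    columnLevel columnRank : ℕ → ℤ
    columnLevel x = level x (S x h)
    columnRank x = rank m n x (S x h)

    columnLevel-zero : columnLevel 0 ≡ 0ℤ
    columnLevel-zero = cong₂ (λ s t → + s ℤ.- + t) (ℕ.*-zeroʳ m) (ℕ.*-zeroʳ n)

    columnLevel-suc : ∀ x → columnLevel (suc x) ℤ.+ + n ≡ columnLevel x ℤ.+ + h x ℤ.* + m
    columnLevel-suc x = begin
      level (suc x) (S (suc x) h) ℤ.+ + n  ≡⟨ cong (λ y → level (suc x) y ℤ.+ + n) (S-last x h) ⟩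
      level (suc x) (S x h + h x) ℤ.+ + n  ≡⟨ cong (λ t → (+ (m * (S x h + h x)) ℤ.- + t) ℤ.+ + n) (ℕ.*-suc n x) ⟩
      (+ (m * (S x h + h x)) ℤ.- (+ n ℤ.+ + (n * x))) ℤ.+ + n
        ≡⟨ lemma (+ (m * (S x h + h x))) (+ n) (+ (n * x)) ⟩
      level x (S x h + h x)                ≡⟨ level-+ x (S x h) (h x) ⟩
      level x (S x h) ℤ.+ + h x ℤ.* + m    ∎
      where
      open ≡-Reasoning
      lemma : ∀ a n b → (a ℤ.- (n ℤ.+ b)) ℤ.+ n ≡ a ℤ.- b
      lemma = ℤ-solve-∀

    columnRank-distinct : ∀ p q → p < m → q < m → p ≢ q → ∀ k → columnRank p ≢ columnRank q ℤ.+ + k ℤ.* + m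
    columnRank-distinct p q p<m q<m p≢q k eq = p≢q (rank-injectiveˣ (S p h) (S q h + k) p q p<m q<m
      (trans eq (sym (rank-+ q (S q h) k))))

    module PathLattice (above-diagonal : ∀ x → x < m → 0ℤ ℤ.≤ columnLevel x) where
      open Lattice m n h columnLevel columnRank columnLevel-zero columnLevel-suc above-diagonal
        (λ p q p<q q<m k lt → subst (ℤ._< columnRank p) (rank-+ q (S q h) k)
          (level<⇒rank< p q p<q q<m (S q h + k) (S p h)
            (subst (ℤ._< columnLevel p) (sym (level-+ q (S q h) k)) lt)))
        (λ p q p<q q<m k le → subst (columnRank p ℤ.≤_) (rank-+ q (S q h) k)
          (level≤⇒rank≤ p q p<q q<m (S p h) (S q h + k)
            (subst (columnLevel p ℤ.≤_) (sym (level-+ q (S q h) k)) le)))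
        (λ p q p<q q<m k lt → subst (columnRank q ℤ.<_) (rank-+ p (S p h) k)
          (level<⇒rank< p q p<q q<m (S q h) (S p h + k)
            (subst (columnLevel q ℤ.<_) (sym (level-+ p (S p h) k)) lt)))
        (λ p q p<q q<m k le → subst (ℤ._≤ columnRank q) (rank-+ p (S p h) k)
          (level≤⇒rank≤ p q p<q q<m (S p h + k) (S q h)
            (subst (ℤ._≤ columnLevel q) (sym (level-+ p (S p h) k)) le)))
        columnRank-distinct
        public

-- Cells of a column

sum-S-comm : ∀ {k} n (f : Fin k → ℕ → ℕ) → sum (λ i → S n (f i)) ≡ S n (λ x → sum (λ i → f i x))
sum-S-comm {zero}  n f = sym (S-zero n (λ _ _ → refl))
sum-S-comm {suc k} n f = trans (cong (λ t → S n (f zero) + t) (sum-S-comm n (f ∘ suc))) (sym (S-distrib-+ n (f zero) _))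

indexIn : ∀ {k} → (Fin k → ℕ) → Fin k → ℕ
indexIn c i = sum (λ j → ⟦ (toℕ j <? toℕ i) ×-dec (c j ≟ c i) ⟧)

fibre : ∀ {k} → (Fin k → ℕ) → ℕ → ℕ
fibre c x = sum (λ i → ⟦ c i ≟ x ⟧)

-- Cars correspond bijectively to cells via column and index within the column. The induction
-- removes the car with the smallest label: it is the lowest of its column, so the remaining cars
-- there lose one from their index, which is the shift built into `G`.
sum-cells : ∀ {k} m (c : Fin k → ℕ) → (∀ i → c i < m) → (F : ℕ → ℕ → ℕ) →
  sum (λ i → F (c i) (indexIn c i)) ≡ S m (λ x → S (fibre c x) (F x))
sum-cells {zero}  m c c<m F = sym (S-zero m (λ _ _ → refl))
sum-cells {suc k} m c c<m F = begin
  F c₀ (indexIn c zero) + sum (λ i → F (c (suc i)) (indexIn c (suc i)))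
    ≡⟨ cong (λ j → F c₀ j + sum (λ i → F (c (suc i)) (indexIn c (suc i))))
        (sum-zero (λ j → ⟦ (toℕ j <? 0) ×-dec (c j ≟ c₀) ⟧) (λ _ → refl)) ⟩
  F c₀ 0 + sum (λ i → G (c (suc i)) (indexIn (c ∘ suc) i))
    ≡⟨ cong₂ _+_ (sym (S-δ m c₀ (λ x → F x 0) (c<m zero))) (sum-cells m (c ∘ suc) (c<m ∘ suc) G) ⟩
  S m (λ x → ⟦ c₀ ≟ x ⟧ * F x 0) + S m (λ x → S (fibre (c ∘ suc) x) (G x))
    ≡⟨ S-distrib-+ m _ _ ⟨
  S m (λ x → ⟦ c₀ ≟ x ⟧ * F x 0 + S (fibre (c ∘ suc) x) (G x))
    ≡⟨ S-cong m (λ x _ → first x (c₀ ≟ x) (fibre (c ∘ suc) x)) ⟩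
  S m (λ x → S (fibre c x) (F x)) ∎
  where
  open ≡-Reasoning
  c₀ = c zero
  G : ℕ → ℕ → ℕ
  G x j = F x (⟦ c₀ ≟ x ⟧ + j)
  first : ∀ x (e : Dec (c₀ ≡ x)) l → ⟦ e ⟧ * F x 0 + S l (λ j → F x (⟦ e ⟧ + j)) ≡ S (⟦ e ⟧ + l) (F x)
  first x (yes _) l = cong (_+ S l (λ j → F x (suc j))) (ℕ.+-identityʳ (F x 0))
  first x (no _)  l = refl

indexIn-mono : ∀ {k} (c : Fin k → ℕ) i j → toℕ i < toℕ j → c i ≡ c j → indexIn c i < indexIn c j
indexIn-mono c i j i<j eq = sum-mono-< _ _
  (λ l → ⟦⟧-mono ((toℕ l <? toℕ i) ×-dec (c l ≟ c i)) ((toℕ l <? toℕ j) ×-dec (c l ≟ c j))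
    (λ (l<i , e) → ℕ.<-trans l<i i<j , trans e eq))
  i
  (subst₂ _<_ (sym (⟦⟧-no ((toℕ i <? toℕ i) ×-dec (c i ≟ c i)) (λ (i<i , _) → ℕ.<-irrefl refl i<i)))
              (sym (⟦⟧-yes ((toℕ i <? toℕ j) ×-dec (c i ≟ c j)) (i<j , eq))) (s≤s z≤n))

-- Injections and sorting

sum-⟦⟧≤1 : ∀ {k} {P : Fin k → Set} (d : ∀ i → Dec (P i)) → (∀ i j → P i → P j → i ≡ j) → sum (λ i → ⟦ d i ⟧) ≤ 1
sum-⟦⟧≤1 {zero}  d unique = z≤n
sum-⟦⟧≤1 {suc k} d unique with d zero
... | yes p = ℕ.≤-reflexive (cong suc (sum-zero _ (λ i → ⟦⟧-no (d (suc i)) (λ q → Fin.0≢1+n (unique zero (suc i) p q)))))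
... | no _  = sum-⟦⟧≤1 (d ∘ suc) (λ i j p q → Fin.suc-injective (unique (suc i) (suc j) p q))

S-≤1 : ∀ n (f : ℕ → ℕ) → (∀ x → x < n → f x ≤ 1) → S n f ≤ n
S-≤1 zero    f le = z≤n
S-≤1 (suc n) f le = ℕ.+-mono-≤ (le 0 (s≤s z≤n)) (S-≤1 n (f ∘ suc) (λ x lt → le (suc x) (s≤s lt)))

S-full : ∀ n (f : ℕ → ℕ) → (∀ x → x < n → f x ≤ 1) → S n f ≡ n → ∀ x → x < n → f x ≡ 1
S-full (suc n) f le eq with f 0 in e | le 0 (s≤s z≤n) | S-≤1 n (f ∘ suc) (λ x lt → le (suc x) (s≤s lt))
... | zero  | _       | le′ = contradiction (subst (_≤ n) eq le′) (ℕ.<⇒≱ ℕ.≤-refl)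
... | suc zero | s≤s z≤n | le′ = λ
  { zero    _        → e
  ; (suc x) (s≤s lt) → S-full n (f ∘ suc) (λ x lt → le (suc x) (s≤s lt)) (ℕ.suc-injective eq) x lt }

-- Double counting: the `n` fibres have at most one element each and together contain `n`, so none
-- is empty.
fibre-injective : ∀ {n} (c : Fin n → ℕ) → (∀ i → c i < n) → (∀ i j → c i ≡ c j → i ≡ j) →
  ∀ x → x < n → fibre c x ≡ 1
fibre-injective {n} c c<n inj = S-full n (fibre c)
  (λ x _ → sum-⟦⟧≤1 (λ i → c i ≟ x) (λ i j p q → inj i j (trans p (sym q))))
  (begin
    S n (fibre c)                          ≡⟨ sum-S-comm n (λ i x → ⟦ c i ≟ x ⟧) ⟨
    sum (λ i → S n (λ x → ⟦ c i ≟ x ⟧))    ≡⟨ sum-cong (λ i → trans (S-cong n (λ x _ → sym (ℕ.*-identityʳ ⟦ c i ≟ x ⟧))) (S-δ n (c i) (λ _ → 1) (c<n i))) ⟩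
    sum {n} (λ _ → 1)                      ≡⟨ sum-ones n ⟩
    n                                      ∎)
  where open ≡-Reasoning

-- Sorting by counting predecessors: `position` is an injection into the numbers below `n`, and
-- `sorted` is its inverse, found through `fibre-injective`. It serves for cars in increasing order
-- of rank and for bottom cells in decreasing order of rank.
module Sort {n : ℕ} (_≺_ : Fin n → Fin n → Set) (_≺?_ : ∀ i j → Dec (i ≺ j))
  (≺-irrefl : ∀ i → ¬ (i ≺ i)) (≺-trans : ∀ {i j k} → i ≺ j → j ≺ k → i ≺ k)
  (≺-connex : ∀ i j → i ≢ j → i ≺ j ⊎ j ≺ i) where

  position : Fin n → ℕ
  position i = sum (λ j → ⟦ j ≺? i ⟧)

  position-mono : ∀ {i j} → i ≺ j → position i < position j
  position-mono {i} {j} i≺j = sum-mono-< _ _ (λ k → ⟦⟧-mono (k ≺? i) (k ≺? j) (λ k≺i → ≺-trans k≺i i≺j)) i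
    (subst₂ _<_ (sym (⟦⟧-no (i ≺? i) (≺-irrefl i))) (sym (⟦⟧-yes (i ≺? j) i≺j)) (s≤s z≤n))

  position<n : ∀ i → position i < n
  position<n i = subst (position i <_) (sum-ones n) (sum-mono-< _ (λ _ → 1) (λ k → ⟦⟧≤1 (k ≺? i)) i
    (subst (_< 1) (sym (⟦⟧-no (i ≺? i) (≺-irrefl i))) (s≤s z≤n)))

  position-injective : ∀ i j → position i ≡ position j → i ≡ j
  position-injective i j eq with i Fin.≟ j
  ... | yes e = e
  ... | no ne with ≺-connex i j ne
  ... | inj₁ lt = contradiction eq (ℕ.<⇒≢ (position-mono lt))
  ... | inj₂ gt = contradiction eq (ℕ.>⇒≢ (position-mono gt))

  private
    at : ∀ (k : Fin n) → ∃ λ i → position i ≡ toℕ k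
    at k with sum-pos (λ i → ⟦ position i ≟ toℕ k ⟧)
                (subst (0 <_) (sym (fibre-injective position position<n position-injective (toℕ k) (Fin.toℕ<n k))) (s≤s z≤n))
    ... | i , p = i , ⟦⟧-pos (position i ≟ toℕ k) p

  sorted : Fin n → Fin n
  sorted k = proj₁ (at k)

  position-sorted : ∀ k → position (sorted k) ≡ toℕ k
  position-sorted k = proj₂ (at k)

  sorted-mono : ∀ {k l} → toℕ k < toℕ l → sorted k ≺ sorted l
  sorted-mono {k} {l} k<l with ≺-connex (sorted k) (sorted l)
      (λ eq → ℕ.<⇒≢ k<l (trans (sym (position-sorted k)) (trans (cong position eq) (position-sorted l))))
  ... | inj₁ lt = lt
  ... | inj₂ gt = contradiction (subst₂ _<_ (position-sorted l) (position-sorted k) (position-mono gt)) (ℕ.<-asym k<l)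

  sorted-injective : ∀ k l → sorted k ≡ sorted l → k ≡ l
  sorted-injective k l eq = Fin.toℕ-injective
    (trans (sym (position-sorted k)) (trans (cong position eq) (position-sorted l)))

  sortPermutation : Permutation n n
  sortPermutation = permutation sorted (λ i → Fin.fromℕ< (position<n i))
    (λ i → position-injective _ _ (trans (position-sorted _) (Fin.toℕ-fromℕ< (position<n i))))
    (λ k → Fin.toℕ-injective (trans (Fin.toℕ-fromℕ< (position<n (sorted k))) (position-sorted k)))

  sum-sorted : ∀ (f : Fin n → ℕ) → sum (f ∘ sorted) ≡ sum f
  sum-sorted f = sym (sum-permute f sortPermutation)

-- Column heights and car ranks

-- `colCount` for a natural abscissa, to which it reduces; this lets heights be summed by `S`.
height : ∀ {m n} → Vec (Fin m) n → ℕ → ℕ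
height v x = count (λ c → does (toℕ c ≟ x)) (toList v)

height≡fibre : ∀ {m n} (v : Vec (Fin m) n) x → height v x ≡ fibre (carX v) x
height≡fibre v x = count-toList (λ c → does (toℕ c ≟ x)) v

index : ∀ {m n} → Vec (Fin m) n → Fin n → ℕ
index v = indexIn (carX v)

carX<m : ∀ {m n} (v : Vec (Fin m) n) i → carX v i < m
carX<m v i = Fin.toℕ<n (lookup v i)

carY≡ : ∀ {m n} (v : Vec (Fin m) n) i → carY v i ≡ belowN v (carX v i) + index v i
carY≡ v i = cong (λ t → belowN v (carX v i) + t) 
  (count-tabulate (λ j → does ((toℕ j <? toℕ i) ×-dec (carX v j ≟ carX v i))) id)

belowN-suc : ∀ {m n} (v : Vec (Fin m) n) x → belowN v (suc x) ≡ belowN v x + height v x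
belowN-suc v x = begin
  belowN v (suc x)                                     ≡⟨ count-toList _ v ⟩
  sum (λ i → ⟦ carX v i <? suc x ⟧)
    ≡⟨ sum-cong (λ i → ⟦⟧-⊎ (carX v i <? suc x) (carX v i <? x) (carX v i ≟ x)
        (λ lt → ℕ.m≤n⇒m<n∨m≡n (s≤s⁻¹ lt)) ℕ.m≤n⇒m≤1+n (λ e → s≤s (ℕ.≤-reflexive e)) ℕ.<⇒≢) ⟩
  sum (λ i → ⟦ carX v i <? x ⟧ + ⟦ carX v i ≟ x ⟧)     ≡⟨ ∑-distrib-+ _ (λ i → ⟦ carX v i ≟ x ⟧) ⟩
  sum (λ i → ⟦ carX v i <? x ⟧) + fibre (carX v) x     ≡⟨ cong₂ _+_ (sym (count-toList _ v)) (sym (height≡fibre v x)) ⟩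
  belowN v x + height v x                              ∎
  where open ≡-Reasoning

belowN≡S : ∀ {m n} (v : Vec (Fin m) n) x → belowN v x ≡ S x (height v)
belowN≡S v zero    = trans (count-toList _ v) (sum-zero {_} (λ i → ⟦ carX v i <? 0 ⟧) (λ _ → refl))
belowN≡S v (suc x) = trans (belowN-suc v x) (trans (cong (_+ height v x) (belowN≡S v x)) (sym (S-last x (height v))))

belowN-full : ∀ {m n} (v : Vec (Fin m) n) → belowN v m ≡ n
belowN-full {m} {n} v = trans (count-toList _ v)
  (trans (sum-cong (λ i → ⟦⟧-yes (carX v i <? m) (carX<m v i))) (sum-ones n))

uptoN≡belowN : ∀ {m n} (v : Vec (Fin m) n) x → uptoN v x ≡ belowN v (suc x)
uptoN≡belowN v x = trans (count-toList _ v) (trans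
  (sum-cong (λ i → ⟦⟧-cong (carX v i ≤? x) (carX v i <? suc x) s≤s s≤s⁻¹)) (sym (count-toList _ v)))

uptoN≡S : ∀ {m n} (v : Vec (Fin m) n) x → uptoN v x ≡ S (suc x) (height v)
uptoN≡S v x = trans (uptoN≡belowN v x) (belowN≡S v (suc x))

sum-cars : ∀ {m n} (v : Vec (Fin m) n) (F : ℕ → ℕ → ℕ) →
  sum (λ i → F (carX v i) (index v i)) ≡ S m (λ x → S (height v x) (F x))
sum-cars {m} v F = trans (sum-cells m (carX v) (carX<m v) F)
  (S-cong m (λ x _ → cong (λ k → S k (F x)) (sym (height≡fibre v x))))

module _ {m n : ℕ} .{{_ : NonZero m}} where
  carRank≡ : ∀ (v : Vec (Fin m) n) i →
    carRank v i ≡ columnRank m n (height v) (carX v i) ℤ.+ + index v i ℤ.* + m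
  carRank≡ v i = trans
    (cong (rank m n (carX v i)) (trans (carY≡ v i) (cong (_+ index v i) (belowN≡S v (carX v i)))))
    (rank-+ m n (carX v i) (S (carX v i) (height v)) (index v i))

  rank-monoʸ : ∀ x {y y′} → y < y′ → rank m n x y ℤ.< rank m n x y′
  rank-monoʸ x lt = ℤ.+-monoˡ-< (+ tie m n x) (ℤ.+-monoˡ-< (ℤ.- + (n * x)) (ℤ.+<+ (ℕ.*-monoʳ-< m lt)))

  carRank-mono : ∀ (v : Vec (Fin m) n) i j → toℕ i < toℕ j → carX v i ≡ carX v j → carRank v i ℤ.< carRank v j
  carRank-mono v i j lt eq = subst (λ x → carRank v i ℤ.< rank m n x (carY v j)) eq
    (rank-monoʸ (carX v i) (subst₂ _<_ (sym (carY≡ v i)) (sym (trans (carY≡ v j) (cong (λ x → belowN v x + index v j) (sym eq))))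
      (ℕ.+-monoʳ-< (belowN v (carX v i)) (indexIn-mono (carX v) i j lt eq))))

  carRank-injective : ∀ (v : Vec (Fin m) n) i j → carRank v i ≡ carRank v j → i ≡ j
  carRank-injective v i j eq with ℕ.<-cmp (toℕ i) (toℕ j)
  ... | tri≈ _ e _ = Fin.toℕ-injective e
  ... | tri< lt _ _ = contradiction eq (ℤ.<⇒≢ (carRank-mono v i j lt
    (rank-injectiveˣ m n (carY v i) (carY v j) (carX v i) (carX v j) (carX<m v i) (carX<m v j) eq)))
  ... | tri> _ _ gt = contradiction (sym eq) (ℤ.<⇒≢ (carRank-mono v j i gt
    (rank-injectiveˣ m n (carY v j) (carY v i) (carX v j) (carX v i) (carX<m v j) (carX<m v i) (sym eq))))

-- Attack relations between ranks

attack : ℕ → ℤ → ℤ → ℕ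
attack m r s = ⟦ (r ℤ.<? s) ×-dec (s ℤ.<? r ℤ.+ + m) ⟧

attack-≥ : ∀ m {r s} → s ℤ.≤ r → attack m r s ≡ 0
attack-≥ m {r} {s} le = ⟦⟧-no ((r ℤ.<? s) ×-dec (s ℤ.<? r ℤ.+ + m)) (λ (lt , _) → ℤ.<⇒≱ lt le)

attacks : ∀ {k} → ℕ → (Fin k → ℤ) → ℕ
attacks m r = sum (λ i → sum (λ j → attack m (r i) (r j)))

tdinvF : ∀ {k} → ℕ → (Fin k → ℤ) → ℕ
tdinvF m r = tdinvL m (List.tabulate r)

tdinv≡ : ∀ {m n} (v : Vec (Fin m) n) → tdinv v ≡ tdinvF m (carRank v)
tdinv≡ {m} v = cong (tdinvL m) (map-tabulate id (carRank v))

tdinvF-suc : ∀ {k} m (r : Fin (suc k) → ℤ) →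
  tdinvF m r ≡ sum (λ j → attack m (r zero) (r (suc j))) + tdinvF m (r ∘ suc)
tdinvF-suc m r = cong (_+ tdinvF m (r ∘ suc))
  (count-tabulate (λ s → does ((r zero ℤ.<? s) ×-dec (s ℤ.<? r zero ℤ.+ + m))) (r ∘ suc))

attacks-suc : ∀ {k} m (r : Fin (suc k) → ℤ) →
  attacks m r ≡ sum (λ j → attack m (r zero) (r (suc j)))
              + (sum (λ i → attack m (r (suc i)) (r zero)) + attacks m (r ∘ suc))
attacks-suc m r = cong₂ _+_
  (cong (_+ sum (λ j → attack m (r zero) (r (suc j)))) (attack-≥ m (ℤ.≤-refl {r zero})))
  (∑-distrib-+ (λ i → attack m (r (suc i)) (r zero)) (λ i → sum (λ j → attack m (r (suc i)) (r (suc j)))))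

tdinvF≤attacks : ∀ {k} m (r : Fin k → ℤ) → tdinvF m r ≤ attacks m r
tdinvF≤attacks {zero}  m r = z≤n
tdinvF≤attacks {suc k} m r = subst₂ _≤_ (sym (tdinvF-suc m r)) (sym (attacks-suc m r))
  (ℕ.+-monoʳ-≤ _ (ℕ.≤-trans (tdinvF≤attacks m (r ∘ suc)) (ℕ.m≤n+m _ _)))

tdinvF-increasing : ∀ {k} m (r : Fin k → ℤ) → (∀ i j → toℕ i < toℕ j → r i ℤ.< r j) → tdinvF m r ≡ attacks m r
tdinvF-increasing {zero}  m r inc = refl
tdinvF-increasing {suc k} m r inc = begin
  tdinvF m r                              ≡⟨ tdinvF-suc m r ⟩
  first + tdinvF m (r ∘ suc)
    ≡⟨ cong (λ t → first + t) (tdinvF-increasing m (r ∘ suc) (λ i j lt → inc (suc i) (suc j) (s≤s lt))) ⟩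
  first + attacks m (r ∘ suc)
    ≡⟨ cong (λ t → first + (t + attacks m (r ∘ suc)))
        (sum-zero (λ i → attack m (r (suc i)) (r zero)) (λ i → attack-≥ m (ℤ.<⇒≤ (inc zero (suc i) (s≤s z≤n))))) ⟨
  first + (sum (λ i → attack m (r (suc i)) (r zero)) + attacks m (r ∘ suc))
    ≡⟨ attacks-suc m r ⟨
  attacks m r ∎
  where
  open ≡-Reasoning
  first = sum (λ j → attack m (r zero) (r (suc j)))

tdinvF-decreasing : ∀ {k} m (r : Fin k → ℤ) → (∀ i j → toℕ i < toℕ j → r j ℤ.< r i) → tdinvF m r ≡ 0
tdinvF-decreasing {zero}  m r dec = refl
tdinvF-decreasing {suc k} m r dec = trans (tdinvF-suc m r) (cong₂ _+_
  (sum-zero (λ j → attack m (r zero) (r (suc j))) (λ j → attack-≥ m (ℤ.<⇒≤ (dec zero (suc j) (s≤s z≤n)))))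
  (tdinvF-decreasing m (r ∘ suc) (λ i j lt → dec (suc i) (suc j) (s≤s lt))))

tdinvF-split : ∀ a {b} m (r : Fin (a + b) → ℤ) →
  tdinvF m r ≡ tdinvF m (r ∘ (_↑ˡ b)) + sum (λ i → sum (λ j → attack m (r (i ↑ˡ b)) (r (a ↑ʳ j)))) + tdinvF m (r ∘ (a ↑ʳ_))
tdinvF-split zero    m r = refl
tdinvF-split (suc a) {b} m r = begin
  tdinvF m r
    ≡⟨ tdinvF-suc m r ⟩
  sum (λ j → attack m (r zero) (r (suc j))) + tdinvF m (r ∘ suc)
    ≡⟨ cong₂ _+_ (sum-split a (λ j → attack m (r zero) (r (suc j)))) (tdinvF-split a m (r ∘ suc)) ⟩
  (near + far) + (tdinvF m (r ∘ suc ∘ (_↑ˡ b)) + cross + rest)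
    ≡⟨ lemma near far (tdinvF m (r ∘ suc ∘ (_↑ˡ b))) cross rest ⟩
  (near + tdinvF m (r ∘ suc ∘ (_↑ˡ b))) + (far + cross) + rest
    ≡⟨ cong (λ t → t + (far + cross) + rest) (sym (tdinvF-suc m (r ∘ (_↑ˡ b)))) ⟩
  tdinvF m (r ∘ (_↑ˡ b)) + (far + cross) + rest ∎
  where
  open ≡-Reasoning
  near = sum (λ j → attack m (r zero) (r (suc (j ↑ˡ b))))
  far = sum (λ j → attack m (r zero) (r (suc (a ↑ʳ j))))
  cross = sum (λ i → sum (λ j → attack m (r (suc (i ↑ˡ b))) (r (suc (a ↑ʳ j)))))
  rest = tdinvF m (r ∘ suc ∘ (a ↑ʳ_))
  lemma : ∀ n f t c s → (n + f) + (t + c + s) ≡ (n + t) + (f + c) + s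
  lemma = ℕ-solve-∀

-- Expressed through the heights alone, so that all labellings of one path share this number.
cellAttacks : ∀ m n .{{_ : NonZero m}} → (ℕ → ℕ) → ℕ
cellAttacks m n h = S m (λ x → S (h x) (λ i → S m (λ x′ → S (h x′) (λ j →
  attack m (columnRank m n h x ℤ.+ + i ℤ.* + m) (columnRank m n h x′ ℤ.+ + j ℤ.* + m)))))

cellAttacks-cong : ∀ m n .{{_ : NonZero m}} (h h′ : ℕ → ℕ) → (∀ x → x < m → h x ≡ h′ x) →
  cellAttacks m n h ≡ cellAttacks m n h′
cellAttacks-cong m n h h′ eq = S-cong m (λ x x<m →
  S-cong₂ (eq x x<m) (λ i → S-cong m (λ x′ x′<m → S-cong₂ (eq x′ x′<m) (λ j →
    cong₂ (λ r s → attack m (r ℤ.+ + i ℤ.* + m) (s ℤ.+ + j ℤ.* + m)) (start x x<m) (start x′ x′<m)))))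
  where
  S-cong₂ : ∀ {k l} {f g : ℕ → ℕ} → k ≡ l → (∀ i → f i ≡ g i) → S k f ≡ S l g
  S-cong₂ {k} refl p = S-cong k (λ i _ → p i)
  start : ∀ x → x < m → columnRank m n h x ≡ columnRank m n h′ x
  start x x<m = cong (rank m n x) (S-cong x (λ x′ x′<x → eq x′ (ℕ.<-trans x′<x x<m)))

attacks≡cellAttacks : ∀ {m n} .{{_ : NonZero m}} (v : Vec (Fin m) n) →
  attacks m (carRank v) ≡ cellAttacks m n (height v)
attacks≡cellAttacks {m} {n} v = trans (sum-cong (λ i → inner (carRank v i)))
  (trans (sum-cong (λ i → cong row (carRank≡ v i)))
    (sum-cars v (λ x i → row (columnRank m n (height v) x ℤ.+ + i ℤ.* + m))))
  where
  row : ℤ → ℕ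
  row r = S m (λ x → S (height v x) (λ j → attack m r (columnRank m n (height v) x ℤ.+ + j ℤ.* + m)))
  inner : ∀ r → sum (λ j → attack m r (carRank v j)) ≡ row r
  inner r = trans (sum-cong (λ j → cong (attack m r) (carRank≡ v j)))
    (sum-cars v (λ x j → attack m r (columnRank m n (height v) x ℤ.+ + j ℤ.* + m)))

-- maxdinv: labelling the cells in increasing order of rank makes every attack count.

allVecs-complete : ∀ {m n} (w : Vec (Fin m) n) → w ∈ allVecs m n
allVecs-complete Vec.[]      = here refl
allVecs-complete (c Vec.∷ w) = ∈-concatMap⁺ (λ c → List.map (c Vec.∷_) (allVecs _ _))
  (Any.map (λ { refl → ∈-map⁺ (c Vec.∷_) (allVecs-complete w) }) (∈-allFin c))

foldr-⊔-≤ : ∀ {A : Set} (g : A → ℕ) b (xs : List A) → (∀ a → g a ≤ b) → List.foldr _⊔_ 0 (List.map g xs) ≤ b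
foldr-⊔-≤ g b []       le = z≤n
foldr-⊔-≤ g b (a ∷ xs) le = ℕ.⊔-lub (le a) (foldr-⊔-≤ g b xs le)

≤-foldr-⊔ : ∀ {A : Set} (g : A → ℕ) {a} {xs : List A} → a ∈ xs → g a ≤ List.foldr _⊔_ 0 (List.map g xs)
≤-foldr-⊔ g (here refl) = ℕ.m≤m⊔n _ _
≤-foldr-⊔ g (there p)   = ℕ.≤-trans (≤-foldr-⊔ g p) (ℕ.m≤n⊔m _ _)

all-true : ∀ {k} (p : Fin k → Bool) → (∀ i → p i ≡ true) → List.foldr _∧_ true (List.tabulate p) ≡ true
all-true {zero}  p eq = refl
all-true {suc k} p eq rewrite eq zero = all-true (p ∘ suc) (eq ∘ suc)

all-true⁻ : ∀ {k} (p : Fin k → Bool) → List.foldr _∧_ true (List.tabulate p) ≡ true → ∀ i → p i ≡ true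
all-true⁻ {suc k} p eq i with p zero in e
all-true⁻ {suc k} p eq zero    | true = e
all-true⁻ {suc k} p eq (suc i) | true = all-true⁻ (p ∘ suc) eq i
all-true⁻ {suc k} p () i       | false

module _ {m n : ℕ} (w v : Vec (Fin m) n) where
  private
    same : Fin m → Bool
    same x = does (height w (toℕ x) ≟ height v (toℕ x))

    samePath≡ : samePath w v ≡ List.foldr _∧_ true (List.tabulate same)
    samePath≡ = cong (List.foldr _∧_ true) (map-tabulate id same)

  samePath-true : (∀ x → x < m → height w x ≡ height v x) → samePath w v ≡ true
  samePath-true eq = trans samePath≡ (all-true same (λ x → dec-true (height w (toℕ x) ≟ height v (toℕ x)) (eq (toℕ x) (Fin.toℕ<n x))))

  samePath-true⁻ : samePath w v ≡ true → ∀ x → x < m → height w x ≡ height v x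
  samePath-true⁻ eq x x<m with height w x ≟ height v x | all-true⁻ same (trans (sym samePath≡) eq) (Fin.fromℕ< x<m)
  ... | yes e | _ = e
  ... | no ne | t rewrite Fin.toℕ-fromℕ< x<m | dec-false (height w x ≟ height v x) ne = contradiction t (λ ())

module _ {m n : ℕ} .{{_ : NonZero m}} (v : Vec (Fin m) n) where
  private
    connex : ∀ i j → i ≢ j → carRank v i ℤ.< carRank v j ⊎ carRank v j ℤ.< carRank v i
    connex i j ne with ℤ.<-cmp (carRank v i) (carRank v j)
    ... | tri< lt _ _ = inj₁ lt
    ... | tri≈ _ e _ = contradiction (carRank-injective v i j e) ne
    ... | tri> _ _ gt = inj₂ gt

    open Sort {n} (λ i j → carRank v i ℤ.< carRank v j) (λ i j → carRank v i ℤ.<? carRank v j)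
      (λ i → ℤ.<-irrefl refl) ℤ.<-trans connex

    -- A vector records only columns, so car `k` is sent to the column of the car with the `k`-th
    -- smallest rank. That it also lands in the very cell of that car is the content of `carRank-w`.
    w : Vec (Fin m) n
    w = Vec.tabulate (lookup v ∘ sorted)

    carX-w : ∀ k → carX w k ≡ carX v (sorted k)
    carX-w k = cong toℕ (lookup∘tabulate (lookup v ∘ sorted) k)

    height-w : ∀ x → height w x ≡ height v x
    height-w x = begin
      height w x                                  ≡⟨ height≡fibre w x ⟩
      sum (λ k → ⟦ carX w k ≟ x ⟧)                ≡⟨ sum-cong (λ k → cong (λ c → ⟦ c ≟ x ⟧) (carX-w k)) ⟩
      sum (λ k → ⟦ carX v (sorted k) ≟ x ⟧)       ≡⟨ sum-sorted (λ i → ⟦ carX v i ≟ x ⟧) ⟩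
      sum (λ i → ⟦ carX v i ≟ x ⟧)                ≡⟨ height≡fibre v x ⟨
      height v x                                  ∎
      where open ≡-Reasoning

    -- Within a column, the order of the ranks is the order of the labels.
    index-w : ∀ k → index w k ≡ index v (sorted k)
    index-w k = trans (sum-cong (λ l → ⟦⟧-cong
        ((toℕ l <? toℕ k) ×-dec (carX w l ≟ carX w k))
        ((toℕ (sorted l) <? toℕ (sorted k)) ×-dec (carX v (sorted l) ≟ carX v (sorted k)))
        (λ (l<k , e) → let e′ = trans (sym (carX-w l)) (trans e (carX-w k)) in
          ℕ.≰⇒> (λ le → ℤ.<-asym (sorted-mono l<k) (below⇒< k l le (sym e′) (ℕ.>⇒≢ l<k))) , e′)
        (λ (lt , e) → ℕ.≰⇒> (λ k≤l → no-inversion k l k≤l lt e) , trans (carX-w l) (trans e (sym (carX-w k))))))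
      (sum-sorted (λ i → ⟦ (toℕ i <? toℕ (sorted k)) ×-dec (carX v i ≟ carX v (sorted k)) ⟧))
      where
      below⇒< : ∀ k l → toℕ (sorted k) ≤ toℕ (sorted l) → carX v (sorted k) ≡ carX v (sorted l) → toℕ k ≢ toℕ l →
                carRank v (sorted k) ℤ.< carRank v (sorted l)
      below⇒< k l le e ne = carRank-mono v (sorted k) (sorted l)
        (ℕ.≤∧≢⇒< le (λ eq → ne (cong toℕ (sorted-injective k l (Fin.toℕ-injective eq))))) e
      no-inversion : ∀ k l → toℕ k ≤ toℕ l → toℕ (sorted l) < toℕ (sorted k) → carX v (sorted l) ≢ carX v (sorted k)
      no-inversion k l k≤l lt e with ℕ.m≤n⇒m<n∨m≡n k≤l
      ... | inj₁ k<l = ℤ.<-asym (sorted-mono k<l) (carRank-mono v (sorted l) (sorted k) lt e)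
      ... | inj₂ k≡l = ℕ.<-irrefl (cong (toℕ ∘ sorted) (sym (Fin.toℕ-injective k≡l))) lt

    carRank-w : ∀ k → carRank w k ≡ carRank v (sorted k)
    carRank-w k = cong₂ (rank m n) (carX-w k) (trans (carY≡ w k) (trans
      (cong₂ _+_ (trans (belowN≡S w (carX w k)) (trans (cong (λ x → S x (height w)) (carX-w k))
                   (trans (S-cong (carX v (sorted k)) (λ x _ → height-w x)) (sym (belowN≡S v (carX v (sorted k)))))))
                 (index-w k))
      (sym (carY≡ v (sorted k)))))

    tdinv-w : tdinv w ≡ cellAttacks m n (height v)
    tdinv-w = begin
      tdinv w                        ≡⟨ tdinv≡ w ⟩
      tdinvF m (carRank w)
        ≡⟨ tdinvF-increasing m (carRank w) (λ k l lt → subst₂ ℤ._<_ (sym (carRank-w k)) (sym (carRank-w l)) (sorted-mono lt)) ⟩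
      attacks m (carRank w)          ≡⟨ attacks≡cellAttacks w ⟩
      cellAttacks m n (height w)     ≡⟨ cellAttacks-cong m n (height w) (height v) (λ x _ → height-w x) ⟩
      cellAttacks m n (height v)     ∎
      where open ≡-Reasoning

  maxdinv≡ : maxdinv v ≡ cellAttacks m n (height v)
  maxdinv≡ = ℕ.≤-antisym
    (foldr-⊔-≤ score (cellAttacks m n (height v)) (allVecs m n) bound)
    (subst (_≤ maxdinv v) (trans (cong (if_then tdinv w else 0) (samePath-true w v (λ x _ → height-w x))) tdinv-w)
      (≤-foldr-⊔ score (allVecs-complete w)))
    where
    score : Vec (Fin m) n → ℕ
    score u = if samePath u v then tdinv u else 0
    bound : ∀ u → score u ≤ cellAttacks m n (height v)
    bound u with samePath u v in e
    ... | false = z≤n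
    ... | true  = subst₂ _≤_ (sym (tdinv≡ u))
      (trans (attacks≡cellAttacks u) (cellAttacks-cong m n (height u) (height v) (samePath-true⁻ u v e)))
      (tdinvF≤attacks m (carRank u))

-- Stretched configurations

findD-unique : ∀ {A : Set} (p : A → Bool) {a} {xs : List A} d → a ∈ xs → p a ≡ true →
  (∀ b → p b ≡ true → b ≡ a) → findD p xs d ≡ a
findD-unique p {xs = b ∷ xs} d a∈ pa unique with p b in e
findD-unique p {xs = b ∷ xs} d a∈          pa unique | true  = unique b e
findD-unique p {xs = b ∷ xs} d (here refl) pa unique | false = contradiction (trans (sym e) pa) (λ ())
findD-unique p {xs = b ∷ xs} d (there a∈)  pa unique | false = findD-unique p d a∈ pa unique

-- Paired with `increasing-≤`, this squeezes a strictly increasing map into an interval of its own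
-- size to the identity. The offset `b` is there for the induction.
≤-increasing : ∀ {k} b (f : Fin k → ℕ) → (∀ i j → toℕ i < toℕ j → f i < f j) → (∀ i → b ≤ f i) → ∀ i → b + toℕ i ≤ f i
≤-increasing b f inc lb zero    = subst (_≤ f zero) (sym (ℕ.+-identityʳ b)) (lb zero)
≤-increasing b f inc lb (suc i) = subst (_≤ f (suc i)) (sym (ℕ.+-suc b (toℕ i)))
  (≤-increasing (suc b) (f ∘ suc) (λ i j lt → inc (suc i) (suc j) (s≤s lt))
    (λ i → ℕ.≤-<-trans (lb zero) (inc zero (suc i) (s≤s z≤n))) i)

increasing-≤ : ∀ {k} b (f : Fin k → ℕ) → (∀ i j → toℕ i < toℕ j → f i < f j) → (∀ i → f i < b + k) → ∀ i → f i ≤ b + toℕ i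
increasing-≤ {suc k} b f inc ub (suc i) = subst (f (suc i) ≤_) (sym (ℕ.+-suc b (toℕ i)))
  (increasing-≤ (suc b) (f ∘ suc) (λ i j lt → inc (suc i) (suc j) (s≤s lt))
    (λ i → subst (f (suc i) <_) (ℕ.+-suc b k) (ub (suc i))) i)
increasing-≤ {suc zero}    b f inc ub zero = subst (f zero ≤_) (sym (ℕ.+-identityʳ b))
  (s≤s⁻¹ (subst (f zero <_) (ℕ.+-comm b 1) (ub zero)))
increasing-≤ {suc (suc k)} b f inc ub zero = s≤s⁻¹ (ℕ.<-≤-trans (inc zero (suc zero) (s≤s z≤n))
  (increasing-≤ (suc b) (f ∘ suc) (λ i j lt → inc (suc i) (suc j) (s≤s lt))
    (λ i → subst (f (suc i) <_) (ℕ.+-suc b (suc k)) (ub (suc i))) zero))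

lookup-≗ : ∀ {A : Set} {k} (u v : Vec A k) → (∀ i → lookup u i ≡ lookup v i) → u ≡ v
lookup-≗ u v eq = trans (sym (Vec.tabulate∘lookup u)) (trans (Vec.tabulate-cong eq) (Vec.tabulate∘lookup v))

level-stretch : ∀ m n x y → + (m * (x + y)) ℤ.- + ((m + n) * x) ≡ + (m * y) ℤ.- + (n * x)
level-stretch m n x y = trans (cong₂ (λ s t → + s ℤ.- + t) (ℕ.*-distribˡ-+ m x y) (ℕ.*-distribʳ-+ x m n))
  (lemma (+ (m * x)) (+ (m * y)) (+ (n * x)))
  where
  lemma : ∀ a b c → (a ℤ.+ b) ℤ.- (a ℤ.+ c) ≡ b ℤ.- c
  lemma = ℤ-solve-∀

-- The `x` extra steps in the columns before `x` add `m x` to the level, which cancels the change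
-- from `n x` to `(m + n) x`.
rank-stretch : ∀ m n x y → rank m (m + n) x (x + y) ≡ rank m n x y
rank-stretch m n x y = cong₂ ℤ._+_ (level-stretch m n x y) (cong (λ d → + divN (x * d) m) (gcd-+ʳ m n))

-- The bottom labels `u` are arbitrary apart from occupying distinct columns. Surjectivity needs
-- this generality: there the ranks in `u ++ v` must be computed before `u` is recognised as
-- `bottomCols v`.
module _ {m n : ℕ} .{{_ : NonZero m}} (u : Vec (Fin m) m) (v : Vec (Fin m) n)
  (u-injective : ∀ i j → carX u i ≡ carX u j → i ≡ j) where
  private
    w = u ++ v
    β = columnRank m n (height v)

    carX-ˡ : ∀ k → carX w (k ↑ˡ n) ≡ carX u k
    carX-ˡ k = cong toℕ (lookup-++ˡ u v k)

    carX-ʳ : ∀ i → carX w (m ↑ʳ i) ≡ carX v i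
    carX-ʳ i = cong toℕ (lookup-++ʳ u v i)

    fibre-u : ∀ x → x < m → fibre (carX u) x ≡ 1
    fibre-u = fibre-injective (carX u) (carX<m u) u-injective

  height-++ : ∀ x → x < m → height w x ≡ suc (height v x)
  height-++ x x<m = begin
    height w x              ≡⟨ height≡fibre w x ⟩
    fibre (carX w) x        ≡⟨ sum-split m (λ i → ⟦ carX w i ≟ x ⟧) ⟩
    sum (λ k → ⟦ carX w (k ↑ˡ n) ≟ x ⟧) + sum (λ i → ⟦ carX w (m ↑ʳ i) ≟ x ⟧)
      ≡⟨ cong₂ _+_ (sum-cong (λ k → cong (λ c → ⟦ c ≟ x ⟧) (carX-ˡ k)))
                   (sum-cong (λ i → cong (λ c → ⟦ c ≟ x ⟧) (carX-ʳ i))) ⟩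
    fibre (carX u) x + fibre (carX v) x
      ≡⟨ cong₂ _+_ (fibre-u x x<m) (sym (height≡fibre v x)) ⟩
    suc (height v x)        ∎
    where open ≡-Reasoning

  S-height-++ : ∀ x → x ≤ m → S x (height w) ≡ x + S x (height v)
  S-height-++ x x≤m = begin
    S x (height w)                    ≡⟨ S-cong x (λ i i<x → height-++ i (ℕ.<-≤-trans i<x x≤m)) ⟩
    S x (λ i → 1 + height v i)        ≡⟨ S-distrib-+ x (λ _ → 1) (height v) ⟩
    S x (λ _ → 1) + S x (height v)    ≡⟨ cong (_+ S x (height v)) (trans (S-const x 1) (ℕ.*-identityʳ x)) ⟩
    x + S x (height v)                ∎
    where open ≡-Reasoning

  columnRank-++ : ∀ x → x ≤ m → columnRank m (m + n) (height w) x ≡ β x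
  columnRank-++ x x≤m = trans (cong (rank m (m + n) x) (S-height-++ x x≤m)) (rank-stretch m n x (S x (height v)))

  columnLevel-++ : ∀ x → x ≤ m → columnLevel m (m + n) (height w) x ≡ columnLevel m n (height v) x
  columnLevel-++ x x≤m = trans (cong (level m (m + n) x) (S-height-++ x x≤m)) (level-stretch m n x (S x (height v)))

  private
    index-ˡ : ∀ k → index w (k ↑ˡ n) ≡ 0
    index-ˡ k = trans (sum-split m (λ j → ⟦ (toℕ j <? toℕ (k ↑ˡ n)) ×-dec (carX w j ≟ carX w (k ↑ˡ n)) ⟧))
      (cong₂ _+_
        (sum-zero _ (λ l → ⟦⟧-no ((toℕ (l ↑ˡ n) <? toℕ (k ↑ˡ n)) ×-dec (carX w (l ↑ˡ n) ≟ carX w (k ↑ˡ n)))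
          (λ (lt , e) → ℕ.<-irrefl (cong (λ l → toℕ (l ↑ˡ n)) (u-injective l k (trans (sym (carX-ˡ l)) (trans e (carX-ˡ k))))) lt)))
        (sum-zero _ (λ j → ⟦⟧-no ((toℕ (m ↑ʳ j) <? toℕ (k ↑ˡ n)) ×-dec (carX w (m ↑ʳ j) ≟ carX w (k ↑ˡ n)))
          (λ (lt , _) → ℕ.<⇒≱ lt (ℕ.<⇒≤ (subst₂ _<_ (sym (Fin.toℕ-↑ˡ k n)) (sym (Fin.toℕ-↑ʳ m j))
            (ℕ.<-≤-trans (Fin.toℕ<n k) (ℕ.m≤m+n m (toℕ j)))))))))

    -- Each column holds exactly one car of `u`, and its label is smaller than every label coming
    -- from `v`.
    index-ʳ : ∀ i → index w (m ↑ʳ i) ≡ suc (index v i)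
    index-ʳ i = trans (sum-split m (λ j → ⟦ (toℕ j <? toℕ (m ↑ʳ i)) ×-dec (carX w j ≟ carX w (m ↑ʳ i)) ⟧))
      (cong₂ _+_
        (trans (sum-cong (λ k → ⟦⟧-cong
            ((toℕ (k ↑ˡ n) <? toℕ (m ↑ʳ i)) ×-dec (carX w (k ↑ˡ n) ≟ carX w (m ↑ʳ i))) (carX u k ≟ carX v i)
            (λ (_ , e) → trans (sym (carX-ˡ k)) (trans e (carX-ʳ i)))
            (λ e → subst₂ _<_ (sym (Fin.toℕ-↑ˡ k n)) (sym (Fin.toℕ-↑ʳ m i))
                     (ℕ.<-≤-trans (Fin.toℕ<n k) (ℕ.m≤m+n m (toℕ i)))
                 , trans (carX-ˡ k) (trans e (sym (carX-ʳ i))))))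
          (fibre-u (carX v i) (carX<m v i)))
        (sum-cong (λ j → ⟦⟧-cong
            ((toℕ (m ↑ʳ j) <? toℕ (m ↑ʳ i)) ×-dec (carX w (m ↑ʳ j) ≟ carX w (m ↑ʳ i)))
            ((toℕ j <? toℕ i) ×-dec (carX v j ≟ carX v i))
            (λ (lt , e) → ℕ.+-cancelˡ-< m _ _ (subst₂ _<_ (Fin.toℕ-↑ʳ m j) (Fin.toℕ-↑ʳ m i) lt)
                        , trans (sym (carX-ʳ j)) (trans e (carX-ʳ i)))
            (λ (lt , e) → subst₂ _<_ (sym (Fin.toℕ-↑ʳ m j)) (sym (Fin.toℕ-↑ʳ m i)) (ℕ.+-monoʳ-< m lt)
                        , trans (carX-ʳ j) (trans e (sym (carX-ʳ i)))))))

  carRank-ˡ : ∀ k → carRank w (k ↑ˡ n) ≡ β (carX u k)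
  carRank-ˡ k = begin
    carRank w (k ↑ˡ n)
      ≡⟨ carRank≡ w (k ↑ˡ n) ⟩
    columnRank m (m + n) (height w) (carX w (k ↑ˡ n)) ℤ.+ + index w (k ↑ˡ n) ℤ.* + m
      ≡⟨ cong₂ (λ x i → columnRank m (m + n) (height w) x ℤ.+ + i ℤ.* + m) (carX-ˡ k) (index-ˡ k) ⟩
    columnRank m (m + n) (height w) (carX u k) ℤ.+ + 0 ℤ.* + m
      ≡⟨ trans (cong (λ t → columnRank m (m + n) (height w) (carX u k) ℤ.+ t) (ℤ.*-zeroˡ (+ m))) (ℤ.+-identityʳ _) ⟩
    columnRank m (m + n) (height w) (carX u k)
      ≡⟨ columnRank-++ (carX u k) (ℕ.<⇒≤ (carX<m u k)) ⟩
    β (carX u k) ∎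
    where open ≡-Reasoning

  carRank-ʳ : ∀ i → carRank w (m ↑ʳ i) ≡ carRank v i ℤ.+ + m
  carRank-ʳ i = begin
    carRank w (m ↑ʳ i)
      ≡⟨ carRank≡ w (m ↑ʳ i) ⟩
    columnRank m (m + n) (height w) (carX w (m ↑ʳ i)) ℤ.+ + index w (m ↑ʳ i) ℤ.* + m
      ≡⟨ cong₂ (λ x i → columnRank m (m + n) (height w) x ℤ.+ + i ℤ.* + m) (carX-ʳ i) (index-ʳ i) ⟩
    columnRank m (m + n) (height w) (carX v i) ℤ.+ + suc (index v i) ℤ.* + m
      ≡⟨ cong (λ r → r ℤ.+ + suc (index v i) ℤ.* + m) (columnRank-++ (carX v i) (ℕ.<⇒≤ (carX<m v i))) ⟩
    β (carX v i) ℤ.+ (1ℤ ℤ.+ + index v i) ℤ.* + m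
      ≡⟨ lemma (β (carX v i)) (+ index v i) (+ m) ⟩
    β (carX v i) ℤ.+ + index v i ℤ.* + m ℤ.+ + m
      ≡⟨ cong (λ r → r ℤ.+ + m) (carRank≡ v i) ⟨
    carRank v i ℤ.+ + m ∎
    where
    open ≡-Reasoning
    lemma : ∀ a k m → a ℤ.+ (1ℤ ℤ.+ k) ℤ.* m ≡ a ℤ.+ k ℤ.* m ℤ.+ m
    lemma = ℤ-solve-∀

  uptoN-++ : ∀ x → x < m → uptoN w x ≡ suc x + uptoN v x
  uptoN-++ x x<m = trans (uptoN≡S w x) (trans (S-height-++ (suc x) x<m) (cong (λ t → suc x + t) (sym (uptoN≡S v x))))

  belowN-++ : ∀ x → x ≤ m → belowN w x ≡ x + belowN v x
  belowN-++ x x≤m = trans (belowN≡S w x) (trans (S-height-++ x x≤m) (cong (λ t → x + t) (sym (belowN≡S v x))))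

  private
    dyck-++ : ∀ x → x < m → m * uptoN w x ≡ m * (x + 1) + m * uptoN v x
    dyck-++ x x<m = trans (cong (m *_) (uptoN-++ x x<m)) (lemma m x (uptoN v x))
      where
      lemma : ∀ m x a → m * (suc x + a) ≡ m * (x + 1) + m * a
      lemma = ℕ-solve-∀

  -- Both sides of the Dyck inequality at column `x` grow by `m (x + 1)`.
  IsPF-++ : IsPF v → IsPF w
  IsPF-++ pf x = subst₂ _≤_ (sym (ℕ.*-distribʳ-+ (toℕ x + 1) m n)) (sym (dyck-++ (toℕ x) (Fin.toℕ<n x)))
    (ℕ.+-monoʳ-≤ (m * (toℕ x + 1)) (pf x))

  IsPF-++⁻ : IsPF w → IsPF v
  IsPF-++⁻ pf x = ℕ.+-cancelˡ-≤ (m * (toℕ x + 1)) _ _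
    (subst₂ _≤_ (ℕ.*-distribʳ-+ (toℕ x + 1) m n) (dyck-++ (toℕ x) (Fin.toℕ<n x)) (pf x))

module _ {m n : ℕ} .{{_ : NonZero m}} (v : Vec (Fin m) n) where
  bottomRank≡ : ∀ x → bottomRank v x ≡ columnRank m n (height v) (toℕ x)
  bottomRank≡ x = trans (cong (rank m (m + n) (toℕ x)) (trans (ℕ.+-comm _ (toℕ x)) (cong (λ t → toℕ x + t) (belowN≡S v (toℕ x)))))
    (rank-stretch m n (toℕ x) (S (toℕ x) (height v)))

  private
    bottomRank-connex : ∀ x y → x ≢ y → bottomRank v y ℤ.< bottomRank v x ⊎ bottomRank v x ℤ.< bottomRank v y
    bottomRank-connex x y x≢y with ℤ.<-cmp (bottomRank v y) (bottomRank v x)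
    ... | tri< lt _ _ = inj₁ lt
    ... | tri> _ _ gt = inj₂ gt
    ... | tri≈ _ e _ = contradiction
      (Fin.toℕ-injective (sym (rank-injectiveˣ m (m + n) _ _ (toℕ y) (toℕ x) (Fin.toℕ<n y) (Fin.toℕ<n x) e))) x≢y

    open Sort {m} (λ x y → bottomRank v y ℤ.< bottomRank v x) (λ x y → bottomRank v y ℤ.<? bottomRank v x)
      (λ x → ℤ.<-irrefl refl) (λ p q → ℤ.<-trans q p) bottomRank-connex

    bottomPos≡ : ∀ x → bottomPos v x ≡ position x
    bottomPos≡ x = count-tabulate (λ y → does (bottomRank v x ℤ.<? bottomRank v y)) id

    bottomCols-at : ∀ k x → position x ≡ toℕ k → lookup (bottomCols v) k ≡ x
    bottomCols-at k x eq = trans (lookup∘tabulate _ k)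
      (findD-unique (λ x → does (bottomPos v x ≟ toℕ k)) k (∈-allFin x)
        (dec-true (bottomPos v x ≟ toℕ k) (trans (bottomPos≡ x) eq)) unique)
      where
      unique : ∀ y → does (bottomPos v y ≟ toℕ k) ≡ true → y ≡ x
      unique y t with bottomPos v y ≟ toℕ k
      ... | yes e = position-injective y x (trans (sym (bottomPos≡ y)) (trans e (sym eq)))
      ... | no ¬e = contradiction (trans (sym (dec-false (bottomPos v y ≟ toℕ k) ¬e)) t) (λ ())

    bottomCols≡sorted : ∀ k → lookup (bottomCols v) k ≡ sorted k
    bottomCols≡sorted k = bottomCols-at k (sorted k) (position-sorted k)

  bottomCols-injective : ∀ i j → carX (bottomCols v) i ≡ carX (bottomCols v) j → i ≡ j
  bottomCols-injective i j eq = sorted-injective i j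
    (trans (sym (bottomCols≡sorted i)) (trans (Fin.toℕ-injective eq) (bottomCols≡sorted j)))

  bottomCols-decreasing : ∀ i j → toℕ i < toℕ j →
    bottomRank v (lookup (bottomCols v) j) ℤ.< bottomRank v (lookup (bottomCols v) i)
  bottomCols-decreasing i j lt = subst₂ (λ x y → bottomRank v x ℤ.< bottomRank v y)
    (sym (bottomCols≡sorted j)) (sym (bottomCols≡sorted i)) (sorted-mono lt)

  -- Decreasing ranks make the positions along `u` strictly increasing; as there are `m` of them
  -- below `m`, car `k` has position `k`.
  bottomCols-unique : ∀ u → (∀ i j → toℕ i < toℕ j → bottomRank v (lookup u j) ℤ.< bottomRank v (lookup u i)) →
    bottomCols v ≡ u
  bottomCols-unique u dec = lookup-≗ (bottomCols v) u (λ k → bottomCols-at k (lookup u k)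
    (ℕ.≤-antisym (increasing-≤ 0 f inc (λ i → position<n (lookup u i)) k) (≤-increasing 0 f inc (λ _ → z≤n) k)))
    where
    f = position ∘ lookup u
    inc : ∀ i j → toℕ i < toℕ j → f i < f j
    inc i j lt = position-mono (dec i j lt)

does-cong : {P Q : Set} (d : Dec P) (e : Dec Q) → (P → Q) → (Q → P) → does d ≡ does e
does-cong d e f g = does-⇔ (mk⇔ f g) d e

-- Descents

tabulate-split : ∀ {A : Set} a {b} (f : Fin (a + b) → A) →
  List.tabulate f ≡ List.tabulate (f ∘ (_↑ˡ b)) List.++ List.tabulate (f ∘ (a ↑ʳ_))
tabulate-split zero    f = refl
tabulate-split (suc a) f = cong (f zero ∷_) (tabulate-split a (f ∘ suc))

idesL-shift : ∀ c k rs → idesL (c + k) rs ≡ List.map (λ i → c + i) (idesL k rs)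
idesL-shift c k []       = refl
idesL-shift c k (a ∷ []) = refl
idesL-shift c k (a ∷ b ∷ rs) = step (a <ℤᵇ b)
  (trans (cong (λ l → idesL l (b ∷ rs)) (sym (ℕ.+-suc c k))) (idesL-shift c (suc k) (b ∷ rs)))
  where
  step : ∀ t {is js} → is ≡ List.map (λ i → c + i) js →
    (if t then c + k ∷ [] else []) List.++ is ≡ List.map (λ i → c + i) ((if t then k ∷ [] else []) List.++ js)
  step true  eq = cong (c + k ∷_) eq
  step false eq = eq

diffs-shift : ∀ c p is n → diffs (c + p) (List.map (λ i → c + i) is) (c + n) ≡ diffs p is n
diffs-shift c p []       n = cong (_∷ []) (ℕ.[m+n]∸[m+o]≡n∸o c n p)
diffs-shift c p (i ∷ is) n = cong₂ _∷_ (ℕ.[m+n]∸[m+o]≡n∸o c i p) (diffs-shift c i is n)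

idesL-translate : ∀ z {l} k (f g : Fin l → ℤ) → (∀ i → f i ≡ g i ℤ.+ z) →
  idesL k (List.tabulate f) ≡ idesL k (List.tabulate g)
idesL-translate z {zero}        k f g eq = refl
idesL-translate z {suc zero}    k f g eq = refl
idesL-translate z {suc (suc l)} k f g eq = cong₂ (λ b is → (if b then k ∷ [] else []) List.++ is)
  (trans (cong₂ _<ℤᵇ_ (eq zero) (eq (suc zero)))
    (does-cong (g zero ℤ.+ z ℤ.<? g (suc zero) ℤ.+ z) (g zero ℤ.<? g (suc zero))
      (λ lt → <ℤ-by lt (lemma (g zero) (g (suc zero)) z)) (ℤ.+-monoˡ-< z)))
  (idesL-translate z (suc k) (f ∘ suc) (g ∘ suc) (eq ∘ suc))
  where
  lemma : ∀ a b z → (b ℤ.+ z) ℤ.- (a ℤ.+ z) ≡ b ℤ.- a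
  lemma = ℤ-solve-∀

-- A single `f i` below `r` yields the ascent at the end of the run, because the last entry is the
-- smallest. The index is left free since the cell known to lie below `r` is the bottom of its
-- column, at an unknown place in the run.
idesL-decreasing : ∀ {l} k (f : Fin (suc l) → ℤ) r rs → (∀ i j → toℕ i < toℕ j → f j ℤ.< f i) →
  ∀ i → f i ℤ.< r → idesL k (List.tabulate f List.++ r ∷ rs) ≡ k + l ∷ idesL (suc (k + l)) (r ∷ rs)
idesL-decreasing {zero} k f r rs dec zero lt
  rewrite dec-true (f zero ℤ.<? r) lt | ℕ.+-identityʳ k = refl
idesL-decreasing {suc l} k f r rs dec i lt
  rewrite dec-false (f zero ℤ.<? f (suc zero)) (ℤ.<-asym (dec zero (suc zero) (s≤s z≤n))) | ℕ.+-suc k l =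
  idesL-decreasing (suc k) (f ∘ suc) r rs (λ i j lt → dec (suc i) (suc j) (s≤s lt)) (proj₁ (later i lt)) (proj₂ (later i lt))
  where
  later : ∀ i → f i ℤ.< r → ∃ λ j → f (suc j) ℤ.< r
  later zero    lt = zero , ℤ.<-trans (dec zero (suc zero) (s≤s z≤n)) lt
  later (suc j) lt = j , lt

idesL-decreasing⁻ : ∀ {l} k (f : Fin (suc l) → ℤ) rs is → idesL k (List.tabulate f List.++ rs) ≡ k + l ∷ is →
  ∀ i j → toℕ i < toℕ j → f j ℤ.≤ f i
idesL-decreasing⁻ {zero}  k f rs is eq zero zero ()
idesL-decreasing⁻ {suc l} k f rs is eq i j lt with f zero ℤ.<? f (suc zero)
-- An ascent here would make `k` the first entry, but the first entry is `k + suc l`.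
... | yes _ = contradiction (∷-injectiveˡ eq) (ℕ.<⇒≢ (ℕ.m<m+n k (s≤s z≤n)))
... | no ge = step i j lt
  where
  tail-decreasing : ∀ i j → toℕ i < toℕ j → f (suc j) ℤ.≤ f (suc i)
  tail-decreasing = idesL-decreasing⁻ (suc k) (f ∘ suc) rs is (trans eq (cong (_∷ is) (ℕ.+-suc k l)))
  step : ∀ i j → toℕ i < toℕ j → f j ℤ.≤ f i
  step zero    (suc zero)    _        = ℤ.≮⇒≥ ge
  step zero    (suc (suc j)) _        = ℤ.≤-trans (tail-decreasing zero (suc j) (s≤s z≤n)) (ℤ.≮⇒≥ ge)
  step (suc i) (suc j)       (s≤s lt) = tail-decreasing i j lt

idesL-run : ∀ {l n} (f : Fin l → ℤ) (g : Fin n → ℤ) → 0 < l → 0 < n → (∀ i j → toℕ i < toℕ j → f j ℤ.< f i) →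
  (∀ j → ∃ λ i → f i ℤ.< g j) →
  idesL 1 (List.tabulate f List.++ List.tabulate g) ≡ l ∷ idesL (suc l) (List.tabulate g)
idesL-run {suc l} {suc n} f g _ _ dec asc =
  idesL-decreasing 1 f (g zero) (List.tabulate (g ∘ suc)) dec (proj₁ (asc zero)) (proj₂ (asc zero))

idesL-run⁻ : ∀ {l} (f : Fin l → ℤ) rs {is} → idesL 1 (List.tabulate f List.++ rs) ≡ l ∷ is →
  ∀ i j → toℕ i < toℕ j → f j ℤ.≤ f i
idesL-run⁻ {suc l} f rs eq = idesL-decreasing⁻ 1 f rs _ eq

-- Without any ascent the only part would be `m + n`, which exceeds `m` because `n` is positive.
diffs-head : ∀ m n → 0 < n → ∀ js {is} → diffs 0 js (m + n) ≡ m ∷ is → ∃ λ js′ → js ≡ m ∷ js′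
diffs-head m n n>0 []       eq = contradiction (∷-injectiveˡ eq) (ℕ.>⇒≢ (ℕ.m<m+n m n>0))
diffs-head m n n>0 (j ∷ js) eq = js , cong (_∷ js) (∷-injectiveˡ eq)

columnRank<carRank+m : ∀ {m n} .{{_ : NonZero m}} (v : Vec (Fin m) n) i →
  columnRank m n (height v) (carX v i) ℤ.< carRank v i ℤ.+ + m
columnRank<carRank+m {m@(suc _)} {n} v i = begin-strict
  c                               ≤⟨ ≤ℤ+ c (index v i * m) ⟩
  c ℤ.+ + (index v i * m)         ≡⟨ cong (λ t → c ℤ.+ t) (ℤ.pos-* (index v i) m) ⟩
  c ℤ.+ + index v i ℤ.* + m       ≡⟨ carRank≡ v i ⟨
  carRank v i                     ≡⟨ ℤ.+-identityʳ (carRank v i) ⟨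
  carRank v i ℤ.+ 0ℤ              <⟨ ℤ.+-monoʳ-< (carRank v i) (ℤ.+<+ (s≤s z≤n)) ⟩
  carRank v i ℤ.+ + m             ∎
  where
  open ℤ.≤-Reasoning
  c = columnRank m n (height v) (carX v i)

module _ {m n : ℕ} .{{_ : NonZero m}} (n>0 : 0 < n) where

  ranks-split : ∀ (w : Vec (Fin m) (m + n)) →
    ranks w ≡ List.tabulate (carRank w ∘ (_↑ˡ n)) List.++ List.tabulate (carRank w ∘ (m ↑ʳ_))
  ranks-split w = trans (map-tabulate id (carRank w)) (tabulate-split m (carRank w))

  pides-vstr : ∀ (v : Vec (Fin m) n) → pides (vstr v) ≡ m ∷ pides v
  pides-vstr v = begin
    diffs 0 (idesL 1 (ranks w)) (m + n)
      ≡⟨ cong (λ rs → diffs 0 (idesL 1 rs) (m + n)) (ranks-split w) ⟩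
    diffs 0 (idesL 1 (List.tabulate bottom List.++ List.tabulate top)) (m + n)
      ≡⟨ cong (λ is → diffs 0 is (m + n)) (idesL-run bottom top (>-nonZero⁻¹ m) n>0 bottom-decreasing ascent) ⟩
    m ∷ diffs m (idesL (suc m) (List.tabulate top)) (m + n)
      ≡⟨ cong (λ is → m ∷ diffs m is (m + n)) (begin
          idesL (suc m) (List.tabulate top)        ≡⟨ cong (λ k → idesL k (List.tabulate top)) (sym (ℕ.+-comm m 1)) ⟩
          idesL (m + 1) (List.tabulate top)        ≡⟨ idesL-shift m 1 (List.tabulate top) ⟩
          List.map (λ i → m + i) (idesL 1 (List.tabulate top))
            ≡⟨ cong (List.map (λ i → m + i)) (idesL-translate (+ m) 1 top (carRank v) (carRank-ʳ u v u-inj)) ⟩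
          List.map (λ i → m + i) (idesL 1 (List.tabulate (carRank v)))
            ≡⟨ cong (λ rs → List.map (λ i → m + i) (idesL 1 rs)) (sym (map-tabulate id (carRank v))) ⟩
          List.map (λ i → m + i) (ides v)                ∎) ⟩
    m ∷ diffs m (List.map (λ i → m + i) (ides v)) (m + n)
      ≡⟨ cong (λ k → m ∷ diffs k (List.map (λ i → m + i) (ides v)) (m + n)) (sym (ℕ.+-identityʳ m)) ⟩
    m ∷ diffs (m + 0) (List.map (λ i → m + i) (ides v)) (m + n)
      ≡⟨ cong (m ∷_) (diffs-shift m 0 (ides v) n) ⟩
    m ∷ pides v ∎
    where
    open ≡-Reasoning
    w = vstr v
    u = bottomCols v
    u-inj = bottomCols-injective v
    bottom = carRank w ∘ (_↑ˡ n)
    top = carRank w ∘ (m ↑ʳ_)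

    bottom≡ : ∀ k → bottom k ≡ bottomRank v (lookup u k)
    bottom≡ k = trans (carRank-ˡ u v u-inj k) (sym (bottomRank≡ v (lookup u k)))

    bottom-decreasing : ∀ i j → toℕ i < toℕ j → bottom j ℤ.< bottom i
    bottom-decreasing i j lt = subst₂ ℤ._<_ (sym (bottom≡ j)) (sym (bottom≡ i)) (bottomCols-decreasing v i j lt)

    -- Each car above m sits above the bottom cell of its own column.
    ascent : ∀ i → ∃ λ k → bottom k ℤ.< top i
    ascent i with sum-pos (λ k → ⟦ carX u k ≟ carX v i ⟧)
      (subst (0 <_) (sym (fibre-injective (carX u) (carX<m u) u-inj (carX v i) (carX<m v i))) (s≤s z≤n))
    ... | k , p = k , subst₂ ℤ._<_ (sym (carRank-ˡ u v u-inj k)) (sym (carRank-ʳ u v u-inj i))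
      (subst (λ x → columnRank m n (height v) x ℤ.< carRank v i ℤ.+ + m)
        (sym (⟦⟧-pos (carX u k ≟ carX v i) p)) (columnRank<carRank+m v i))

  module _ (u : Vec (Fin m) m) (v : Vec (Fin m) n) {is : List ℕ} (eq : pides (u ++ v) ≡ m ∷ is) where
    private
      w = u ++ v

      first-run : ∃ λ js → ides w ≡ m ∷ js
      first-run = diffs-head m n n>0 (ides w) eq

      first-decreasing : ∀ i j → toℕ i < toℕ j → carRank w (j ↑ˡ n) ℤ.≤ carRank w (i ↑ˡ n)
      first-decreasing = idesL-run⁻ (carRank w ∘ (_↑ˡ n)) (List.tabulate (carRank w ∘ (m ↑ʳ_)))
        (trans (cong (idesL 1) (sym (ranks-split w))) (proj₂ first-run))

      distinct-columns : ∀ i j → toℕ i < toℕ j → carX u i ≢ carX u j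
      distinct-columns i j lt e = ℤ.<⇒≱ (carRank-mono w (i ↑ˡ n) (j ↑ˡ n)
        (subst₂ _<_ (sym (Fin.toℕ-↑ˡ i n)) (sym (Fin.toℕ-↑ˡ j n)) lt)
        (trans (cong toℕ (lookup-++ˡ u v i)) (trans e (sym (cong toℕ (lookup-++ˡ u v j))))))
        (first-decreasing i j lt)

    first-run-injective : ∀ i j → carX u i ≡ carX u j → i ≡ j
    first-run-injective i j e with ℕ.<-cmp (toℕ i) (toℕ j)
    ... | tri< lt _ _ = contradiction e (distinct-columns i j lt)
    ... | tri≈ _ e′ _ = Fin.toℕ-injective e′
    ... | tri> _ _ gt = contradiction (sym e) (distinct-columns j i gt)

    vstr-surjective : vstr v ≡ u ++ v
    vstr-surjective = cong (_++ v) (bottomCols-unique v u λ i j lt →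
      subst₂ ℤ._<_ (rank≡ j) (rank≡ i) (ℤ.≤∧≢⇒< (first-decreasing i j lt)
        (λ e → ℕ.<-irrefl (trans (sym (Fin.toℕ-↑ˡ i n)) (trans (cong toℕ (sym (carRank-injective w _ _ e))) (Fin.toℕ-↑ˡ j n))) lt)))
      where
      rank≡ : ∀ k → carRank w (k ↑ˡ n) ≡ bottomRank v (lookup u k)
      rank≡ k = trans (carRank-ˡ u v first-run-injective k) (sym (bottomRank≡ v (lookup u k)))

-- Area and returns

belowN≤n : ∀ {m n} (v : Vec (Fin m) n) x → x ≤ m → belowN v x ≤ n
belowN≤n {m} v x x≤m = subst₂ _≤_ (sym (belowN≡S v x)) (trans (sym (belowN≡S v m)) (belowN-full v)) (S-mono (height v) x≤m)

area≡ : ∀ {m n} (v : Vec (Fin m) n) →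
  area v ≡ sum {m} (λ x → S n (λ y → ⟦ (y <? uptoN v (toℕ x)) ×-dec (n * (toℕ x + 1) ≤? m * y) ⟧))
area≡ {m} {n} v = trans (foldr-map-tabulate column id)
  (sum-cong {n = m} (λ x → count-applyUpTo n (λ y → does ((y <? uptoN v (toℕ x)) ×-dec (n * (toℕ x + 1) ≤? m * y))) id))
  where
  column : Fin m → ℕ
  column x = count (λ y → does ((y <? uptoN v (toℕ x)) ×-dec (n * (toℕ x + 1) ≤? m * y))) (upTo n)

-- The lowest `x + 1` rows of column `x` fail the diagonal condition, the next `n` rows copy the old
-- column, and the remaining `m - x - 1` rows lie above the path.
area-stretch : ∀ m n x U → x < m → U ≤ n →
  S (m + n) (λ y → ⟦ (y <? suc x + U) ×-dec ((m + n) * (x + 1) ≤? m * y) ⟧) ≡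
  S n (λ y → ⟦ (y <? U) ×-dec (n * (x + 1) ≤? m * y) ⟧)
area-stretch m n x U x<m U≤n = begin
  S (m + n) f                        ≡⟨ cong (λ k → S k f) m+n ⟩
  S (suc x + (n + (m ∸ suc x))) f    ≡⟨ S-split (suc x) (n + (m ∸ suc x)) f ⟩
  S (suc x) f + S (n + (m ∸ suc x)) (λ y → f (suc x + y))
    ≡⟨ cong₂ _+_ (S-zero (suc x) below) (S-split n (m ∸ suc x) (λ y → f (suc x + y))) ⟩
  S n (λ y → f (suc x + y)) + S (m ∸ suc x) (λ y → f (suc x + (n + y)))
    ≡⟨ cong₂ _+_ (S-cong n (λ y _ → middle y)) (S-zero (m ∸ suc x) (λ y _ → above y)) ⟩
  S n (λ y → ⟦ (y <? U) ×-dec (n * (x + 1) ≤? m * y) ⟧) + 0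
    ≡⟨ ℕ.+-identityʳ _ ⟩
  S n (λ y → ⟦ (y <? U) ×-dec (n * (x + 1) ≤? m * y) ⟧) ∎
  where
  open ≡-Reasoning
  f : ℕ → ℕ
  f y = ⟦ (y <? suc x + U) ×-dec ((m + n) * (x + 1) ≤? m * y) ⟧
  m+n : m + n ≡ suc x + (n + (m ∸ suc x))
  m+n = trans (cong (_+ n) (sym (ℕ.m+[n∸m]≡n x<m))) (lemma (suc x) (m ∸ suc x) n)
    where
    lemma : ∀ a b c → a + b + c ≡ a + (c + b)
    lemma = ℕ-solve-∀
  below : ∀ y → y < suc x → f y ≡ 0
  below y y≤x = ⟦⟧-no ((y <? suc x + U) ×-dec ((m + n) * (x + 1) ≤? m * y))
    (λ (_ , le) → ℕ.<⇒≱ (ℕ.<-≤-trans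
      (ℕ.*-monoʳ-< m {{>-nonZero (ℕ.≤-<-trans z≤n x<m)}} (subst (y <_) (ℕ.+-comm 1 x) y≤x))
      (ℕ.*-monoˡ-≤ (x + 1) (ℕ.m≤m+n m n))) le)
  cells : ∀ y → m * (suc x + y) ≡ m * (x + 1) + m * y
  cells = lemma m x
    where
    lemma : ∀ m x y → m * (suc x + y) ≡ m * (x + 1) + m * y
    lemma = ℕ-solve-∀
  middle : ∀ y → f (suc x + y) ≡ ⟦ (y <? U) ×-dec (n * (x + 1) ≤? m * y) ⟧
  middle y = ⟦⟧-cong ((suc x + y <? suc x + U) ×-dec ((m + n) * (x + 1) ≤? m * (suc x + y)))
    ((y <? U) ×-dec (n * (x + 1) ≤? m * y))
    (λ (lt , le) → ℕ.+-cancelˡ-< (suc x) y U lt ,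
      ℕ.+-cancelˡ-≤ (m * (x + 1)) _ _ (subst₂ _≤_ (ℕ.*-distribʳ-+ (x + 1) m n) (cells y) le))
    (λ (lt , le) → ℕ.+-monoʳ-< (suc x) lt ,
      subst₂ _≤_ (sym (ℕ.*-distribʳ-+ (x + 1) m n)) (sym (cells y)) (ℕ.+-monoʳ-≤ (m * (x + 1)) le))
  above : ∀ y → f (suc x + (n + y)) ≡ 0
  above y = ⟦⟧-no ((suc x + (n + y) <? suc x + U) ×-dec ((m + n) * (x + 1) ≤? m * (suc x + (n + y))))
    (λ (lt , _) → ℕ.<⇒≱ (ℕ.+-cancelˡ-< (suc x) (n + y) U lt) (ℕ.≤-trans U≤n (ℕ.m≤m+n n y)))

area-++ : ∀ {m n} .{{_ : NonZero m}} (u : Vec (Fin m) m) (v : Vec (Fin m) n) →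
  (∀ i j → carX u i ≡ carX u j → i ≡ j) → area (u ++ v) ≡ area v
area-++ {m} {n} u v u-inj = trans (area≡ (u ++ v)) (trans (sum-cong column) (sym (area≡ v)))
  where
  column : ∀ (x : Fin m) → S (m + n) (λ y → ⟦ (y <? uptoN (u ++ v) (toℕ x)) ×-dec ((m + n) * (toℕ x + 1) ≤? m * y) ⟧)
         ≡ S n (λ y → ⟦ (y <? uptoN v (toℕ x)) ×-dec (n * (toℕ x + 1) ≤? m * y) ⟧)
  column x = trans
    (cong (λ U → S (m + n) (λ y → ⟦ (y <? U) ×-dec ((m + n) * (toℕ x + 1) ≤? m * y) ⟧)) (uptoN-++ u v u-inj (toℕ x) (Fin.toℕ<n x)))
    (area-stretch m n (toℕ x) (uptoN v (toℕ x)) (Fin.toℕ<n x)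
      (subst (_≤ n) (sym (uptoN≡belowN v (toℕ x))) (belowN≤n v (suc (toℕ x)) (Fin.toℕ<n x))))

belowN-dyck : ∀ {m n} (v : Vec (Fin m) n) → IsPF v → ∀ x → x ≤ m → n * x ≤ m * belowN v x
belowN-dyck {m} {n} v pf zero    _   = subst (_≤ m * belowN v 0) (sym (ℕ.*-zeroʳ n)) z≤n
belowN-dyck {m} {n} v pf (suc x) x<m = subst₂ (λ a y → n * a ≤ m * y)
  (trans (cong (_+ 1) (Fin.toℕ-fromℕ< x<m)) (ℕ.+-comm x 1))
  (trans (cong (uptoN v) (Fin.toℕ-fromℕ< x<m)) (uptoN≡belowN v x))
  (pf (Fin.fromℕ< x<m))

-- At a point of the diagonal the bound `b ≤ uptoN v a` follows from the Dyck condition, so only the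
-- bound that transforms under `belowN-++` remains.
passes-diagonal : ∀ {m n} .{{_ : NonZero m}} (v : Vec (Fin m) n) → IsPF v → ∀ a b → a ≤ m → m * b ≡ n * a →
  passes v a b ≡ does (belowN v a ≤? b)
passes-diagonal {m} {n} v pf a b a≤m eq = trans
  (cong (λ t → does (belowN v a ≤? b) ∧ t) (dec-true (b ≤? uptoN v a) (ℕ.≤-trans
    (ℕ.*-cancelˡ-≤ m (subst (_≤ m * belowN v a) (sym eq) (belowN-dyck v pf a a≤m)))
    (subst (belowN v a ≤_) (sym (trans (uptoN≡belowN v a) (belowN-suc v a))) (ℕ.m≤m+n _ _)))))
  (∧-identityʳ _)

findD-applyUpTo : ∀ {A : Set} (p q : A → Bool) k (f : ℕ → A) d → (∀ i → i < k → p (f i) ≡ q (f i)) →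
  findD p (applyUpTo f k) d ≡ findD q (applyUpTo f k) d
findD-applyUpTo p q zero    f d eq = refl
findD-applyUpTo p q (suc k) f d eq = cong₂ (λ b r → if b then f 0 else r) (eq 0 (s≤s z≤n))
  (findD-applyUpTo p q k (f ∘ suc) d (λ i lt → eq (suc i) (s≤s lt)))

-- The candidate point at abscissa `a` moves up by `a`, and so does the start of the path's column
-- there; the number of candidates is unchanged.
ret-++ : ∀ {m n} .{{_ : NonZero m}} (u : Vec (Fin m) m) (v : Vec (Fin m) n) →
  (∀ i j → carX u i ≡ carX u j → i ≡ j) → IsPF v → ret (u ++ v) ≡ ret v
ret-++ {m} {n} u v u-inj pf = begin
  ret w
    ≡⟨ cong (λ k → findD (λ i → passes w (i * divN m k) (i * divN (m + n) k)) (List.map suc (upTo k)) k) (gcd-+ʳ m n) ⟩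
  findD (λ i → passes w (i * divN m k) (i * divN (m + n) k)) (List.map suc (upTo k)) k
    ≡⟨ cong (λ l → findD (λ i → passes w (i * divN m k) (i * divN (m + n) k)) l k) (map-applyUpTo id suc k) ⟩
  findD (λ i → passes w (i * divN m k) (i * divN (m + n) k)) (applyUpTo suc k) k
    ≡⟨ findD-applyUpTo _ _ k suc k (λ i i<k → same (suc i) i<k) ⟩
  findD (λ i → passes v (i * divN m k) (i * divN n k)) (applyUpTo suc k) k
    ≡⟨ cong (λ l → findD (λ i → passes v (i * divN m k) (i * divN n k)) l k) (map-applyUpTo id suc k) ⟨
  ret v ∎
  where
  open ≡-Reasoning
  w = u ++ v
  k = gcd m n
  m₀ = divN m k
  n₀ = divN n k
  m₀k : m₀ * k ≡ m
  m₀k = trans (cong (_* k) (divN≡/ m k)) (m/n*n≡m (gcd[m,n]∣m m n))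
  n₀k : n₀ * k ≡ n
  n₀k = trans (cong (_* k) (divN≡/ n k)) (m/n*n≡m (gcd[m,n]∣n m n))
  quotient-+ : divN (m + n) k ≡ m₀ + n₀
  quotient-+ = trans (divN≡/ (m + n) k) (trans (+-distrib-/-∣ˡ n (gcd[m,n]∣m m n))
    (sym (cong₂ _+_ (divN≡/ m k) (divN≡/ n k))))
  same : ∀ i → i ≤ k → passes w (i * m₀) (i * divN (m + n) k) ≡ passes v (i * m₀) (i * n₀)
  same i i≤k = begin
    passes w a (i * divN (m + n) k)
      ≡⟨ cong (passes w a) (trans (cong (i *_) quotient-+) (ℕ.*-distribˡ-+ i m₀ n₀)) ⟩
    passes w a (a + b)
      ≡⟨ passes-diagonal w (IsPF-++ u v u-inj pf) a (a + b) a≤m (trans (ℕ.*-distribˡ-+ m a b)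
          (trans (cong (λ t → m * a + t) on-diagonal) (sym (ℕ.*-distribʳ-+ a m n)))) ⟩
    does (belowN w a ≤? a + b)
      ≡⟨ cong (λ y → does (y ≤? a + b)) (belowN-++ u v u-inj a a≤m) ⟩
    does (a + belowN v a ≤? a + b)
      ≡⟨ does-cong (a + belowN v a ≤? a + b) (belowN v a ≤? b) (ℕ.+-cancelˡ-≤ a _ _) (ℕ.+-monoʳ-≤ a) ⟩
    does (belowN v a ≤? b)
      ≡⟨ passes-diagonal v pf a b a≤m on-diagonal ⟨
    passes v a b ∎
    where
    a = i * m₀
    b = i * n₀
    a≤m : a ≤ m
    a≤m = subst (a ≤_) (trans (ℕ.*-comm k m₀) m₀k) (ℕ.*-monoˡ-≤ m₀ i≤k)
    on-diagonal : m * b ≡ n * a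
    on-diagonal = trans (cong (_* b) (sym m₀k)) (trans (lemma m₀ k i n₀) (cong (_* a) n₀k))
      where
      lemma : ∀ a k i b → a * k * (i * b) ≡ b * k * (i * a)
      lemma = ℕ-solve-∀

-- pdinv as a sum over pairs of columns

-- The convention that division by zero gives infinity agrees with the cross-multiplied inequality,
-- as `(a + 1) n` is positive.
fracLtᵇ≡ : ∀ m n a l → 0 < n → fracLtᵇ m n (suc a) l ≡ does (m * l <? suc a * n)
fracLtᵇ≡ m n a zero    n>0 = sym (dec-true (m * 0 <? suc a * n)
  (subst (_< suc a * n) (sym (ℕ.*-zeroʳ m)) (ℕ.<-≤-trans n>0 (ℕ.m≤m+n n (a * n)))))
fracLtᵇ≡ m n a (suc l) n>0 = refl

S-between : ∀ m x q → x < q → q ≤ m → S m (λ x′ → ⟦ (x <? x′) ×-dec (x′ <? q) ⟧) + suc x ≡ q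
S-between m x q x<q q≤m = begin
  S m (λ x′ → ⟦ (x <? x′) ×-dec (x′ <? q) ⟧) + suc x
    ≡⟨ cong (λ t → S m (λ x′ → ⟦ (x <? x′) ×-dec (x′ <? q) ⟧) + t) (S-⟦<⟧ m (suc x) (ℕ.≤-trans x<q q≤m)) ⟨
  S m (λ x′ → ⟦ (x <? x′) ×-dec (x′ <? q) ⟧) + S m (λ x′ → ⟦ x′ <? suc x ⟧)
    ≡⟨ S-distrib-+ m _ _ ⟨
  S m (λ x′ → ⟦ (x <? x′) ×-dec (x′ <? q) ⟧ + ⟦ x′ <? suc x ⟧)
    ≡⟨ S-cong m (λ x′ _ → ⟦⟧-⊎ (x′ <? q) ((x <? x′) ×-dec (x′ <? q)) (x′ <? suc x)
        (split x′) proj₂ (λ lt → ℕ.≤-trans lt x<q) (λ (gt , _) lt → ℕ.<⇒≱ gt (s≤s⁻¹ lt))) ⟨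
  S m (λ x′ → ⟦ x′ <? q ⟧)
    ≡⟨ S-⟦<⟧ m q q≤m ⟩
  q ∎
  where
  open ≡-Reasoning
  split : ∀ x′ → x′ < q → (x < x′ × x′ < q) ⊎ x′ < suc x
  split x′ lt with x <? x′
  ... | yes gt = inj₁ (gt , lt)
  ... | no ¬gt = inj₂ (s≤s (ℕ.≮⇒≥ ¬gt))

-- Pairs formed by the east step over column p and a north step of column q ≥ p + 1
-- whose rank intervals overlap.
contacts : ℕ → ℕ → (ℕ → ℤ) → ℕ → ℕ → ℕ → ℕ
contacts m n b k p q = S k (λ j →
  ⟦ (b (suc p) ℤ.≤? b q ℤ.+ + suc j ℤ.* + m) ×-dec (b q ℤ.+ + j ℤ.* + m ℤ.<? b (suc p) ℤ.+ + n) ⟧)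

module _ {m n : ℕ} .{{_ : NonZero m}} (v : Vec (Fin m) n) where
  private
    h = height v
    b = columnLevel m n h

    row-≤ : ∀ x q j → j < h q → S (suc x) h ≤ S q h + j → x < q
    row-≤ x q j j<h le = ℕ.≰⇒> (λ q≤x → ℕ.<⇒≱ (ℕ.+-monoʳ-< (S q h) j<h)
      (ℕ.≤-trans (ℕ.≤-reflexive (sym (S-last q h))) (ℕ.≤-trans (S-mono h (s≤s q≤x)) le)))

    row-≤⁻ : ∀ x q j → x < q → S (suc x) h ≤ S q h + j
    row-≤⁻ x q j x<q = ℕ.≤-trans (S-mono h x<q) (ℕ.m≤m+n _ j)

    cell : Fin m → ℕ → ℕ
    cell x y = if does (uptoN v (toℕ x) ≤? y) ∧ fracLeᵇ (armC v x y) (suc (legC v x y)) m n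
                  ∧ fracLtᵇ m n (suc (armC v x y)) (legC v x y) then 1 else 0

    arm+x : ∀ x q j → toℕ x < q → q < m → j < h q → armC v x (S q h + j) + suc (toℕ x) ≡ q
    arm+x x q j x<q q<m j<h = trans (cong (_+ suc (toℕ x)) arm≡) (S-between m (toℕ x) q x<q (ℕ.<⇒≤ q<m))
      where
      arm≡ : armC v x (S q h + j) ≡ S m (λ x′ → ⟦ (toℕ x <? x′) ×-dec (x′ <? q) ⟧)
      arm≡ = trans
        (count-tabulate {n = m} (λ x′ → does ((toℕ x <? toℕ x′) ×-dec (uptoN v (toℕ x′) ≤? S q h + j))) id)
        (trans (sum-cong {n = m} (λ x′ → ⟦⟧-cong
            ((toℕ x <? toℕ x′) ×-dec (uptoN v (toℕ x′) ≤? S q h + j)) ((toℕ x <? toℕ x′) ×-dec (toℕ x′ <? q))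
            (λ (lt , le) → lt , row-≤ (toℕ x′) q j j<h (subst (_≤ S q h + j) (uptoN≡S v (toℕ x′)) le))
            (λ (lt , lt′) → lt , subst (_≤ S q h + j) (sym (uptoN≡S v (toℕ x′))) (row-≤⁻ (toℕ x′) q j lt′))))
          (sum-toℕ m (λ x′ → ⟦ (toℕ x <? x′) ×-dec (x′ <? q) ⟧)))

    leg+c : ∀ x q j → toℕ x < q → legC v x (S q h + j) + S (suc (toℕ x)) h ≡ S q h + j
    leg+c x q j x<q = trans (cong (λ c → S q h + j ∸ c + S (suc (toℕ x)) h) (uptoN≡S v (toℕ x)))
      (ℕ.m∸n+n≡m (row-≤⁻ (toℕ x) q j x<q))

    -- Arm and leg are the coordinate differences between the right end of the east step below the
    -- cell and the lower end of the north step in its row, so this combination of them is a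
    -- difference of levels.
    leg-arm : ∀ a x l c → + (m * l) ℤ.- + (a * n) ≡ level m n (a + x) (l + c) ℤ.- level m n x c
    leg-arm a x l c = trans (lemma (+ (m * l)) (+ (a * n)) (+ (m * c)) (+ (n * x)))
      (sym (cong₂ (λ s t → (+ s ℤ.- + t) ℤ.- level m n x c) (ℕ.*-distribˡ-+ m l c) (lemmaℕ n a x)))
      where
      lemma : ∀ ml an mc nx → ml ℤ.- an ≡ ((ml ℤ.+ mc) ℤ.- (an ℤ.+ nx)) ℤ.- (mc ℤ.- nx)
      lemma = ℤ-solve-∀
      lemmaℕ : ∀ n a x → n * (a + x) ≡ a * n + n * x
      lemmaℕ = ℕ-solve-∀

    cell-left : ∀ x q j → 0 < n → toℕ x < q → q < m → j < h q → cell x (S q h + j) ≡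
      ⟦ (b (suc (toℕ x)) ℤ.≤? b q ℤ.+ + suc j ℤ.* + m) ×-dec (b q ℤ.+ + j ℤ.* + m ℤ.<? b (suc (toℕ x)) ℤ.+ + n) ⟧
    cell-left x q j n>0 x<q q<m j<h = trans
      (cong (λ t → if does (uptoN v (toℕ x) ≤? y) ∧ (does (a * n ≤? m * suc l) ∧ t) then 1 else 0) (fracLtᵇ≡ m n a l n>0))
      (⟦⟧-cong ((uptoN v (toℕ x) ≤? y) ×-dec ((a * n ≤? m * suc l) ×-dec (m * l <? suc a * n)))
        ((b (suc (toℕ x)) ℤ.≤? b q ℤ.+ + suc j ℤ.* + m) ×-dec (b q ℤ.+ + j ℤ.* + m ℤ.<? b (suc (toℕ x)) ℤ.+ + n))
        (λ (_ , le , lt) → ≤ℤ-by (ℤ.+≤+ le) diff≤ , <ℤ-by (ℤ.+<+ lt) diff<)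
        (λ (le , lt) → subst (_≤ y) (sym (uptoN≡S v (toℕ x))) (row-≤⁻ (toℕ x) q j x<q) ,
          ℤ.drop‿+≤+ (≤ℤ-by le (sym diff≤)) , ℤ.drop‿+<+ (<ℤ-by lt (sym diff<))))
      where
      y = S q h + j
      a = armC v x y
      l = legC v x y
      c = S (suc (toℕ x)) h
      diff≤ : + (m * suc l) ℤ.- + (a * n) ≡ (b q ℤ.+ + suc j ℤ.* + m) ℤ.- b (suc (toℕ x))
      diff≤ = trans (leg-arm a (suc (toℕ x)) (suc l) c) (cong (λ t → t ℤ.- b (suc (toℕ x)))
        (trans (cong₂ (level m n) (arm+x x q j x<q q<m j<h)
                 (trans (cong suc (leg+c x q j x<q)) (sym (ℕ.+-suc (S q h) j))))
          (level-+ m n q (S q h) (suc j))))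
      diff< : + (suc a * n) ℤ.- + (m * l) ≡ (b (suc (toℕ x)) ℤ.+ + n) ℤ.- (b q ℤ.+ + j ℤ.* + m)
      diff< = trans (lemma₁ (+ n) (+ (a * n)) (+ (m * l)))
        (trans (cong (λ t → + n ℤ.- t)
            (trans (leg-arm a (suc (toℕ x)) l c) (cong (λ t → t ℤ.- b (suc (toℕ x)))
              (trans (cong₂ (level m n) (arm+x x q j x<q q<m j<h) (leg+c x q j x<q)) (level-+ m n q (S q h) j)))))
          (lemma₂ (+ n) (b q ℤ.+ + j ℤ.* + m) (b (suc (toℕ x)))))
        where
        lemma₁ : ∀ n an ml → (n ℤ.+ an) ℤ.- ml ≡ n ℤ.- (ml ℤ.- an)
        lemma₁ = ℤ-solve-∀
        lemma₂ : ∀ n r s → n ℤ.- (r ℤ.- s) ≡ (s ℤ.+ n) ℤ.- r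
        lemma₂ = ℤ-solve-∀

    cell-right : ∀ x q j → q ≤ toℕ x → j < h q → cell x (S q h + j) ≡ 0
    cell-right x q j q≤x j<h = cong (λ t → if t ∧ (fracLeᵇ (armC v x y) (suc (legC v x y)) m n
        ∧ fracLtᵇ m n (suc (armC v x y)) (legC v x y)) then 1 else 0)
      (dec-false (uptoN v (toℕ x) ≤? y) (λ le → ℕ.<⇒≱ (row-≤ (toℕ x) q j j<h (subst (_≤ y) (uptoN≡S v (toℕ x)) le)) q≤x))
      where
      y = S q h + j

    -- Contacts extended by zero to `p ≥ q`: in such rows the cell lies below the path and
    -- contributes nothing to `pdinv`.
    G : ℕ → ℕ → ℕ
    G p q = ⟦ p <? q ⟧ * contacts m n b (h q) p q

    G-< : ∀ {p q} → p < q → G p q ≡ contacts m n b (h q) p q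
    G-< {p} {q} p<q = trans (cong (_* contacts m n b (h q) p q) (⟦⟧-yes (p <? q) p<q)) (ℕ.*-identityˡ _)

    G-≥ : ∀ {p q} → q ≤ p → G p q ≡ 0
    G-≥ {p} {q} q≤p = cong (_* contacts m n b (h q) p q) (⟦⟧-no (p <? q) (ℕ.≤⇒≯ q≤p))

    block : ∀ x q → 0 < n → q < m → S (h q) (λ j → cell x (S q h + j)) ≡ G (toℕ x) q
    block x q n>0 q<m with toℕ x <? q
    ... | yes x<q = trans (S-cong (h q) (λ j j<h → cell-left x q j n>0 x<q q<m j<h)) (sym (G-< x<q))
    ... | no x≮q  = trans (S-zero (h q) (λ j j<h → cell-right x q j (ℕ.≮⇒≥ x≮q) j<h)) (sym (G-≥ (ℕ.≮⇒≥ x≮q)))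

    column : ∀ x → 0 < n → S n (cell x) ≡ S m (G (toℕ x))
    column x n>0 = trans (cong (λ k → S k (cell x)) (trans (sym (belowN-full v)) (belowN≡S v m)))
      (trans (S-blocks m h (cell x)) (S-cong m (λ q q<m → block x q n>0 q<m)))

  pdinv≡ : 0 < n → pdinv v ≡ S m (λ q → S q (λ p → contacts m n b (h q) p q))
  pdinv≡ n>0 = begin
    pdinv v
      ≡⟨ foldr-map-tabulate (λ x → count (cellᵇ x) (upTo n)) id ⟩
    sum (λ x → count (cellᵇ x) (upTo n))
      ≡⟨ sum-cong {n = m} (λ x → trans (count-applyUpTo n (cellᵇ x) id) (column x n>0)) ⟩
    sum {m} (λ x → S m (G (toℕ x)))
      ≡⟨ sum-toℕ m (λ p → S m (G p)) ⟩
    S m (λ p → S m (G p))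
      ≡⟨ S-triangle m G ⟩
    S m (λ q → S q (λ p → G p q + G q p) + G q q)
      ≡⟨ S-cong m (λ q _ → trans (cong₂ _+_
          (S-cong q (λ p p<q → trans (cong₂ _+_ (G-< p<q) (G-≥ (ℕ.<⇒≤ p<q))) (ℕ.+-identityʳ _)))
          (G-≥ {q} ℕ.≤-refl)) (ℕ.+-identityʳ _)) ⟩
    S m (λ q → S q (λ p → contacts m n b (h q) p q)) ∎
    where
    open ≡-Reasoning
    cellᵇ : Fin m → ℕ → Bool
    cellᵇ x y = does (uptoN v (toℕ x) ≤? y) ∧ fracLeᵇ (armC v x y) (suc (legC v x y)) m n
                ∧ fracLtᵇ m n (suc (armC v x y)) (legC v x y)

-- Invariance of dinv

attack-translate : ∀ m z r s → attack m (r ℤ.+ z) (s ℤ.+ z) ≡ attack m r s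
attack-translate m z r s = ⟦⟧-cong
  ((r ℤ.+ z ℤ.<? s ℤ.+ z) ×-dec (s ℤ.+ z ℤ.<? r ℤ.+ z ℤ.+ + m)) ((r ℤ.<? s) ×-dec (s ℤ.<? r ℤ.+ + m))
  (λ (lt , lt′) → <ℤ-by lt (lemma₁ r s z) , <ℤ-by lt′ (lemma₂ r s z (+ m)))
  (λ (lt , lt′) → <ℤ-by lt (sym (lemma₁ r s z)) , <ℤ-by lt′ (sym (lemma₂ r s z (+ m))))
  where
  lemma₁ : ∀ r s z → (s ℤ.+ z) ℤ.- (r ℤ.+ z) ≡ s ℤ.- r
  lemma₁ = ℤ-solve-∀
  lemma₂ : ∀ r s z m → (r ℤ.+ z ℤ.+ m) ℤ.- (s ℤ.+ z) ≡ (r ℤ.+ m) ℤ.- s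
  lemma₂ = ℤ-solve-∀

tdinvF-cong : ∀ {k} m {r s : Fin k → ℤ} → (∀ i → r i ≡ s i) → tdinvF m r ≡ tdinvF m s
tdinvF-cong m eq = cong (tdinvL m) (tabulate-cong eq)

tdinvF-translate : ∀ {k} m z (r : Fin k → ℤ) → tdinvF m (λ i → r i ℤ.+ z) ≡ tdinvF m r
tdinvF-translate {zero}  m z r = refl
tdinvF-translate {suc k} m z r = trans (tdinvF-suc m (λ i → r i ℤ.+ z)) (trans
  (cong₂ _+_ (sum-cong (λ j → attack-translate m z (r zero) (r (suc j)))) (tdinvF-translate m z (r ∘ suc)))
  (sym (tdinvF-suc m r)))

module _ {m n : ℕ} .{{_ : NonZero m}} (n>0 : 0 < n) (v : Vec (Fin m) n) (pf : IsPF v) where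
  private
    u = bottomCols v
    w = u ++ v
    u-inj = bottomCols-injective v
    h = height v
    β = columnRank m n h
    b = columnLevel m n h

    b-nonneg : ∀ x → x < m → 0ℤ ℤ.≤ b x
    b-nonneg x x<m = ℤ.i≤j⇒0≤j-i (ℤ.+≤+ (subst (λ y → n * x ≤ m * y) (belowN≡S v x) (belowN-dyck v pf x (ℕ.<⇒≤ x<m))))

    open PathLattice m n h b-nonneg

    -- `cross` counts attacks of bottom cells on upper cells, all seen by `tdinv` because bottom
    -- cells carry the smallest labels. `excess` counts attacks on bottom cells, none of them seen
    -- by `tdinv`: an upper attacker has the larger label, and the bottom labels decrease in rank.
    -- `maxdinv` gains both numbers, and `pdinv` has to make up for `excess`.
    cross excess : ℕ
    cross = S m (λ x → S m (λ x′ → S (h x′) (λ j → attack m (β x) (β x′ ⊕ suc j))))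
    excess = S m (λ x → S m (λ x′ → above x x′ + sub x x′))

    sum-over-u : ∀ f → sum (λ k → f (carX u k)) ≡ S m f
    sum-over-u f = trans (sum-cells m (carX u) (carX<m u) (λ x _ → f x))
      (S-cong m (λ x x<m → trans
        (cong (λ k → S k (λ _ → f x)) (fibre-injective (carX u) (carX<m u) u-inj x x<m))
        (ℕ.+-identityʳ (f x))))

    tdinv-stretch : tdinv w ≡ cross + tdinv v
    tdinv-stretch = begin
      tdinv w
        ≡⟨ tdinv≡ w ⟩
      tdinvF m (carRank w)
        ≡⟨ tdinvF-split m m (carRank w) ⟩
      tdinvF m (carRank w ∘ (_↑ˡ n)) + sum (λ k → sum (λ i → attack m (carRank w (k ↑ˡ n)) (carRank w (m ↑ʳ i))))
        + tdinvF m (carRank w ∘ (m ↑ʳ_))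
        ≡⟨ cong₂ _+_ (cong₂ _+_
            (tdinvF-decreasing m (carRank w ∘ (_↑ˡ n)) (λ i j lt → subst₂ ℤ._<_ (bottom j) (bottom i) (bottomCols-decreasing v i j lt)))
            (trans (sum-cong (λ k → trans (cong-row k) (row (β (carX u k))))) (sum-over-u (λ x → S m (λ x′ → S (h x′) (λ j → attack m (β x) (β x′ ⊕ suc j)))))))
            (trans (tdinvF-cong m (carRank-ʳ u v u-inj)) (trans (tdinvF-translate m (+ m) (carRank v)) (sym (tdinv≡ v)))) ⟩
      cross + tdinv v ∎
      where
      open ≡-Reasoning
      bottom : ∀ k → bottomRank v (lookup u k) ≡ carRank w (k ↑ˡ n)
      bottom k = trans (bottomRank≡ v (lookup u k)) (sym (carRank-ˡ u v u-inj k))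
      cong-row : ∀ k → sum (λ i → attack m (carRank w (k ↑ˡ n)) (carRank w (m ↑ʳ i)))
                     ≡ sum (λ i → attack m (β (carX u k)) (carRank v i ℤ.+ + m))
      cong-row k = sum-cong (λ i → cong₂ (attack m) (carRank-ˡ u v u-inj k) (carRank-ʳ u v u-inj i))
      row : ∀ r → sum (λ i → attack m r (carRank v i ℤ.+ + m)) ≡ S m (λ x′ → S (h x′) (λ j → attack m r (β x′ ⊕ suc j)))
      row r = trans
        (sum-cong (λ i → cong (attack m r) (trans (cong (λ s → s ℤ.+ + m) (carRank≡ v i)) (sym (⊕-suc (β (carX v i)) (index v i))))))
        (sum-cars v (λ x′ j → attack m r (β x′ ⊕ suc j)))

    above-diag : ∀ q → above q q ≡ 0
    above-diag q = S-zero (h q) (λ j _ → ⟦⟧-no ((β q ⊕ suc j ℤ.<? β q) ×-dec (β q ℤ.<? β q ⊕ suc (suc j)))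
      (λ (lt , _) → ℤ.<⇒≱ lt (≤-⊕ (β q) (suc j))))

    pdinv-stretch : pdinv w ≡ pdinv v + excess
    pdinv-stretch = begin
      pdinv w
        ≡⟨ pdinv≡ w (ℕ.<-≤-trans n>0 (ℕ.m≤n+m n m)) ⟩
      S m (λ q → S q (λ p → contacts m (m + n) (columnLevel m (m + n) (height w)) (height w q) p q))
        ≡⟨ S-cong m (λ q q<m → trans (S-cong q (λ p p<q → meet≡ p q p<q q<m)) (stretched-row q q<m)) ⟩
      S m (λ q → S q (λ p → meet p q) + S q (λ p → (above p q + sub p q) + (above q p + sub q p)))
        ≡⟨ S-distrib-+ m _ _ ⟩
      S m (λ q → S q (λ p → meet p q)) + S m (λ q → S q (λ p → (above p q + sub p q) + (above q p + sub q p)))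
        -- A vanishing diagonal is inserted to match the right-hand side of `S-triangle`; a bottom
        -- cell is attacked by no cell of its own column.
        ≡⟨ cong₂ _+_ (sym (pdinv≡ v n>0)) (S-cong m (λ q _ → sym (trans
            (cong (λ t → S q (λ p → (above p q + sub p q) + (above q p + sub q p)) + t) (diag q))
            (ℕ.+-identityʳ _)))) ⟩
      pdinv v + S m (λ q → S q (λ p → (above p q + sub p q) + (above q p + sub q p)) + (above q q + sub q q))
        ≡⟨ cong (λ t → pdinv v + t) (sym (S-triangle m (λ x x′ → above x x′ + sub x x′))) ⟩
      pdinv v + excess ∎
      where
      open ≡-Reasoning
      diag : ∀ q → above q q + sub q q ≡ 0
      diag q = cong₂ _+_ (above-diag q) (attack-≥ m {β q} ℤ.≤-refl)
      meet≡ : ∀ p q → p < q → q < m →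
        contacts m (m + n) (columnLevel m (m + n) (height w)) (height w q) p q ≡ stretchedMeet p q
      meet≡ p q p<q q<m = trans
        (cong (λ k → contacts m (m + n) (columnLevel m (m + n) (height w)) k p q) (height-++ u v u-inj q q<m))
        (S-cong (suc (h q)) (λ j _ → step j
          (columnLevel-++ u v u-inj (suc p) (ℕ.<-trans p<q q<m)) (columnLevel-++ u v u-inj q (ℕ.<⇒≤ q<m))))
        where
        lemma : ∀ b m n → b ℤ.+ (m ℤ.+ n) ≡ b ℤ.+ n ℤ.+ m
        lemma = ℤ-solve-∀
        step : ∀ j {s t s′ t′} → s ≡ s′ → t ≡ t′ →
          ⟦ (s ℤ.≤? t ⊕ suc j) ×-dec (t ⊕ j ℤ.<? s ℤ.+ + (m + n)) ⟧ ≡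
          ⟦ (s′ ℤ.≤? t′ ⊕ suc j) ×-dec (t′ ⊕ j ℤ.<? s′ ℤ.+ + n ℤ.+ + m) ⟧
        step j {s} {t} refl refl = cong (λ c → ⟦ (s ℤ.≤? t ⊕ suc j) ×-dec (t ⊕ j ℤ.<? c) ⟧) (lemma s (+ m) (+ n))

    maxdinv-stretch : maxdinv w ≡ excess + cross + maxdinv v
    maxdinv-stretch = begin
      maxdinv w
        ≡⟨ maxdinv≡ w ⟩
      cellAttacks m (m + n) (height w)
        ≡⟨ S-cong m (λ x x<m → S-cong₂ (height-++ u v u-inj x x<m) (λ i →
            S-cong m (λ x′ x′<m → S-cong₂ (height-++ u v u-inj x′ x′<m) (λ j →
              cong₂ (λ r s → attack m (r ⊕ i) (s ⊕ j))
                (columnRank-++ u v u-inj x (ℕ.<⇒≤ x<m)) (columnRank-++ u v u-inj x′ (ℕ.<⇒≤ x′<m)))))) ⟩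
      S m (λ x → S (suc (h x)) (λ i → S m (λ x′ → S (suc (h x′)) (λ j → attack m (β x ⊕ i) (β x′ ⊕ j)))))
        ≡⟨ S-cong m (λ x _ → split x) ⟩
      S m (λ x → (P x 0 + Q x 0) + (S (h x) (λ i → P x (suc i)) + S (h x) (λ i → Q x (suc i))))
        ≡⟨ trans (S-distrib-+ m (λ x → P x 0 + Q x 0) (λ x → S (h x) (λ i → P x (suc i)) + S (h x) (λ i → Q x (suc i))))
            (cong₂ _+_ (S-distrib-+ m (λ x → P x 0) (λ x → Q x 0))
              (S-distrib-+ m (λ x → S (h x) (λ i → P x (suc i))) (λ x → S (h x) (λ i → Q x (suc i))))) ⟩
      (S m (λ x → P x 0) + S m (λ x → Q x 0)) + (S m (λ x → S (h x) (λ i → P x (suc i))) + S m (λ x → S (h x) (λ i → Q x (suc i))))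
        ≡⟨ cong₂ _+_ (cong₂ _+_ P₀ Q₀) (cong₂ _+_ P₁ Q₁) ⟩
      (S m (λ x → S m (sub x)) + cross) + (S m (λ x → S m (above x)) + maxdinv v)
        ≡⟨ lemma (S m (λ x → S m (sub x))) cross (S m (λ x → S m (above x))) (maxdinv v) ⟩
      (S m (λ x → S m (above x)) + S m (λ x → S m (sub x))) + cross + maxdinv v
        ≡⟨ cong (λ t → t + cross + maxdinv v) (trans
            (sym (S-distrib-+ m (λ x → S m (above x)) (λ x → S m (sub x))))
            (S-cong m (λ x _ → sym (S-distrib-+ m (above x) (sub x))))) ⟩
      excess + cross + maxdinv v ∎
      where
      open ≡-Reasoning
      -- The attacks of cell `i` of column `x`: `P` on bottom cells and `Q` on upper cells.
      -- Separating `i = 0` from the rest gives four kinds of pairs; upper cells attacking upper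
      -- cells are the old attacks, translated by `m`.
      P Q : ℕ → ℕ → ℕ
      P x i = S m (λ x′ → attack m (β x ⊕ i) (β x′ ⊕ 0))
      Q x i = S m (λ x′ → S (h x′) (λ j → attack m (β x ⊕ i) (β x′ ⊕ suc j)))
      split : ∀ x → S (suc (h x)) (λ i → S m (λ x′ → S (suc (h x′)) (λ j → attack m (β x ⊕ i) (β x′ ⊕ j)))) ≡
        (P x 0 + Q x 0) + (S (h x) (λ i → P x (suc i)) + S (h x) (λ i → Q x (suc i)))
      split x = trans
        (S-cong (suc (h x)) (λ i _ → S-distrib-+ m (λ x′ → attack m (β x ⊕ i) (β x′ ⊕ 0))
          (λ x′ → S (h x′) (λ j → attack m (β x ⊕ i) (β x′ ⊕ suc j)))))
        (cong (λ t → P x 0 + Q x 0 + t) (S-distrib-+ (h x) (λ i → P x (suc i)) (λ i → Q x (suc i))))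
      lemma : ∀ s c a d → (s + c) + (a + d) ≡ (a + s) + c + d
      lemma = ℕ-solve-∀
      S-cong₂ : ∀ {k l} {f g : ℕ → ℕ} → k ≡ l → (∀ i → f i ≡ g i) → S k f ≡ S l g
      S-cong₂ {k} refl eq = S-cong k (λ i _ → eq i)
      P₀ : S m (λ x → P x 0) ≡ S m (λ x → S m (sub x))
      P₀ = S-cong m (λ x _ → S-cong m (λ x′ _ → cong₂ (attack m) (⊕-zero (β x)) (⊕-zero (β x′))))
      Q₀ : S m (λ x → Q x 0) ≡ cross
      Q₀ = S-cong m (λ x _ → cong (λ r → S m (λ x′ → S (h x′) (λ j → attack m r (β x′ ⊕ suc j)))) (⊕-zero (β x)))
      P₁ : S m (λ x → S (h x) (λ i → P x (suc i))) ≡ S m (λ x → S m (above x))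
      P₁ = begin
        S m (λ x → S (h x) (λ i → S m (λ x′ → attack m (β x ⊕ suc i) (β x′ ⊕ 0))))
          ≡⟨ S-cong m (λ x _ → S-comm (h x) m (λ i x′ → attack m (β x ⊕ suc i) (β x′ ⊕ 0))) ⟩
        S m (λ x → S m (λ x′ → S (h x) (λ i → attack m (β x ⊕ suc i) (β x′ ⊕ 0))))
          ≡⟨ S-comm m m (λ x x′ → S (h x) (λ i → attack m (β x ⊕ suc i) (β x′ ⊕ 0))) ⟩
        S m (λ x′ → S m (λ x → S (h x) (λ i → attack m (β x ⊕ suc i) (β x′ ⊕ 0))))
          ≡⟨ S-cong m (λ x′ _ → S-cong m (λ x _ → S-cong (h x) (λ i _ → cong₂
              (λ s t → ⟦ (β x ⊕ suc i ℤ.<? s) ×-dec (s ℤ.<? t) ⟧) (⊕-zero (β x′)) (sym (⊕-suc (β x) (suc i)))))) ⟩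
        S m (λ x′ → S m (above x′)) ∎
      Q₁ : S m (λ x → S (h x) (λ i → Q x (suc i))) ≡ maxdinv v
      Q₁ = trans (S-cong m (λ x _ → S-cong (h x) (λ i _ → S-cong m (λ x′ _ → S-cong (h x′) (λ j _ →
          trans (cong₂ (attack m) (⊕-suc (β x) i) (⊕-suc (β x′) j)) (attack-translate m (+ m) (β x ⊕ i) (β x′ ⊕ j)))))))
        (sym (maxdinv≡ v))

  dinv-vstr : dinv (vstr v) ≡ dinv v
  dinv-vstr = trans
    (cong₂ ℤ._-_ (cong₂ (λ s t → + s ℤ.+ + t) tdinv-stretch pdinv-stretch) (cong +_ maxdinv-stretch))
    (lemma (+ cross) (+ tdinv v) (+ pdinv v) (+ excess) (+ maxdinv v))
    where
    lemma : ∀ c t p e d → ((c ℤ.+ t) ℤ.+ (p ℤ.+ e)) ℤ.- ((e ℤ.+ c) ℤ.+ d) ≡ (t ℤ.+ p) ℤ.- d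
    lemma = ℤ-solve-∀

-- Bijectivity and the collected statistics

module _ {m n : ℕ} .{{_ : NonZero m}} (n>0 : 0 < n) {is : List ℕ} where
  private
    Preimage : Vec (Fin m) (m + n) → Set
    Preimage w = IsPF w → pides w ≡ m ∷ is → Σ[ v ∈ Vec (Fin m) n ] (IsPF v × pides v ≡ is × vstr v ≡ w)

    preimage-++ : ∀ (u : Vec (Fin m) m) (v : Vec (Fin m) n) → Preimage (u ++ v)
    preimage-++ u v pf eq = v , IsPF-++⁻ u v (first-run-injective n>0 u v eq) pf ,
      ∷-injectiveʳ (trans (sym (pides-vstr n>0 v)) (trans (cong pides (vstr-surjective n>0 u v eq)) eq)) ,
      vstr-surjective n>0 u v eq

  vstr-maps-into : ∀ (v : Vec (Fin m) n) → IsPF v → pides v ≡ is → IsPF (vstr v) × pides (vstr v) ≡ m ∷ is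
  vstr-maps-into v pf eq = IsPF-++ (bottomCols v) v (bottomCols-injective v) pf ,
    trans (pides-vstr n>0 v) (cong (m ∷_) eq)

  vstr-preimage : ∀ w → IsPF w → pides w ≡ m ∷ is → Σ[ v ∈ Vec (Fin m) n ] (IsPF v × pides v ≡ is × vstr v ≡ w)
  vstr-preimage w with u , v , w≡ ← splitAt m w = subst Preimage (sym w≡) (preimage-++ u v)

vstr-injective : ∀ {m n} (v v′ : Vec (Fin m) n) → vstr v ≡ vstr v′ → v ≡ v′
vstr-injective v v′ = ++-injectiveʳ (bottomCols v) (bottomCols v′)

vstr-statistics : ∀ {m n} .{{_ : NonZero m}} → 0 < n → (v : Vec (Fin m) n) → IsPF v →
  area (vstr v) ≡ area v × dinv (vstr v) ≡ dinv v × ret (vstr v) ≡ ret v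
vstr-statistics n>0 v pf = area-++ (bottomCols v) v (bottomCols-injective v) ,
  dinv-vstr n>0 v pf ,
  ret-++ (bottomCols v) v (bottomCols-injective v) pf

-- The parts of `compo m α` are listed from `m` downward, so raising the multiplicity of `m` by one
-- prepends a single `m`.
theorem9 : (m n : ℕ) → 0 < m → 0 < n → (α : ℕ → ℕ) → wsum m α ≡ n →
    (∀ (v : Vec (Fin m) n) → IsPF v → pides v ≡ compo m α →
    IsPF (vstr v) × pides (vstr v) ≡ m ∷ compo m α)
    × (∀ (v v′ : Vec (Fin m) n) → IsPF v → pides v ≡ compo m α →
    IsPF v′ → pides v′ ≡ compo m α → vstr v ≡ vstr v′ → v ≡ v′)
    × (∀ (w : Vec (Fin m) (m + n)) → IsPF w → pides w ≡ m ∷ compo m α →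
    Σ[ v ∈ Vec (Fin m) n ] (IsPF v × pides v ≡ compo m α × vstr v ≡ w))
    × (∀ (v : Vec (Fin m) n) → IsPF v → pides v ≡ compo m α →
    area (vstr v) ≡ area v × dinv (vstr v) ≡ dinv v × ret (vstr v) ≡ ret v)
theorem9 m n m>0 n>0 α _ =
  vstr-maps-into {{>-nonZero m>0}} n>0 ,
  (λ v v′ _ _ _ _ → vstr-injective v v′) ,
  vstr-preimage {{>-nonZero m>0}} n>0 ,
  (λ v pf _ → vstr-statistics {{>-nonZero m>0}} n>0 v pf)
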